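{- There is a function $f(k)=2^{O(k^2)}$ such that every $k$-cut-minimal directed graph has directed treewidth at most $f(k)$.
   Context: An $s$-$t$-cut in a directed graph $G=(V,A)$ with $s,t\in V$ is a set $C\subseteq A$ of arcs such that $G-C$ has no directed path from $s$ to $t$; it is minimal if it is inclusion-minimal among $s$-$t$-cuts. A directed graph $G$ is $k$-cut-minimal (for arc-cuts) if it contains a source vertex $s$ and a sink vertex $t$ (two distinguished vertices), and every vertex other than $s,t$ is incident to at least one arc that belongs to some inclusion-minimal $s$-$t$-cut of size at most $k$. Directed treewidth is the standard width measure for directed graphs (of Johnson, Robertson, Seymour and Thomas). -}

module Defs where

open import Data.Nat using (ℕ; suc; _≤_)
open import Data.Fin using (Fin)
open import Data.Fin.Subset using (Subset; _∈_; _∉_; _⊆_; ∣_∣)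
open import Data.Maybe using (Maybe; just; nothing)
open import Data.Product using (Σ; ∃; _×_)
open import Data.Sum using (_⊎_)
open import Data.Empty using (⊥)
open import Relation.Nullary using (¬_)
open import Relation.Binary.PropositionalEquality using (_≡_; _≢_)

record Digraph : Set where
  field
    n    : ℕ
    m    : ℕ
    tail : Fin m → Fin n
    head : Fin m → Fin n

open Digraph public

-- no parallel arcs (a directed graph G = (V, A) with A ⊆ V × V)
Simple : Digraph → Set
Simple G = ∀ a b → tail G a ≡ tail G b → head G a ≡ head G b → a ≡ b

data ReachAvoidingArcs (G : Digraph) (C : Subset (m G)) : Fin (n G) → Fin (n G) → Set where
  here : ∀ {u} → ReachAvoidingArcs G C u u
  step : ∀ {u v} (a : Fin (m G)) → a ∉ C → tail G a ≡ u →
         ReachAvoidingArcs G C (head G a) v → ReachAvoidingArcs G C u v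

IsCut : (G : Digraph) → Fin (n G) → Fin (n G) → Subset (m G) → Set
IsCut G s t C = ¬ ReachAvoidingArcs G C s t

IsMinimalCut : (G : Digraph) → Fin (n G) → Fin (n G) → Subset (m G) → Set
IsMinimalCut G s t C = IsCut G s t C × (∀ C′ → C′ ⊆ C → IsCut G s t C′ → C ⊆ C′)

Incident : (G : Digraph) → Fin (m G) → Fin (n G) → Set
Incident G a v = tail G a ≡ v ⊎ head G a ≡ v

KCutMinimal : ℕ → Digraph → Set
KCutMinimal k G =
  Σ (Fin (n G)) λ s → Σ (Fin (n G)) λ t → s ≢ t ×
    (∀ v → v ≢ s → v ≢ t →
      Σ (Fin (m G)) λ a → Incident G a v ×
        Σ (Subset (m G)) λ C → IsMinimalCut G s t C × a ∈ C × ∣ C ∣ ≤ k)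

-- Directed treewidth (Johnson, Robertson, Seymour, Thomas)

data WalkAvoiding (G : Digraph) (X : Subset (n G)) : Fin (n G) → Fin (n G) → Set where
  here : ∀ {u} → u ∉ X → WalkAvoiding G X u u
  step : ∀ {u v} (a : Fin (m G)) → u ∉ X → tail G a ≡ u →
         WalkAvoiding G X (head G a) v → WalkAvoiding G X u v

Guarded : (G : Digraph) → Subset (n G) → (Fin (n G) → Set) → Set
Guarded G X Z =
  (∀ v → Z v → v ∉ X) ×
  (∀ u z w → Z u → ¬ Z z → Z w → WalkAvoiding G X u z → WalkAvoiding G X z w → ⊥)

data Below {p : ℕ} (par : Fin p → Maybe (Fin p)) (x : Fin p) : Fin p → Set where
  self : Below par x x
  down : ∀ {y z} → par y ≡ just z → Below par x z → Below par x y

-- An arboreal decomposition (R, B, W) of G of width at most w.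
-- R is an arborescence on nodes Fin p given by parent pointers with root `root`;
-- its arcs are (x, y) with parent y ≡ just x, and B y is the guard of the arc into y.
record ArborealDecomposition (G : Digraph) (w : ℕ) : Set where
  field
    p        : ℕ
    parent   : Fin p → Maybe (Fin p)
    root     : Fin p
    rootTop  : parent root ≡ nothing
    rooted   : ∀ y → Below parent root y
    B        : Fin p → Subset (n G)
    W        : Fin p → Subset (n G)
    nonempty : ∀ y → Σ (Fin (n G)) λ v → v ∈ W y
    cover    : ∀ v → Σ (Fin p) λ y → v ∈ W y
    disjoint : ∀ v y y′ → v ∈ W y → v ∈ W y′ → y ≡ y′
    guarded  : ∀ x y → parent y ≡ just x →
               Guarded G (B y) (λ v → Σ (Fin p) λ z → Below parent y z × v ∈ W z)
    -- width: for every node y, |W(y) ∪ ⋃_{e ∼ y} B(e)| ≤ w + 1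
    width    : ∀ y (S : Subset (n G)) →
               (∀ v → v ∈ S →
                  v ∈ W y
                  ⊎ ((Σ (Fin p) λ x → parent y ≡ just x) × v ∈ B y)
                  ⊎ (Σ (Fin p) λ z → parent z ≡ just y × v ∈ B z)) →
               ∣ S ∣ ≤ suc w

DirectedTreewidth≤ : Digraph → ℕ → Set
DirectedTreewidth≤ G w = ArborealDecomposition G w

{-# OPTIONS --safe #-}

-- Fix a vertex set X and call a set large if it contains more than half of X.  Suppose that
-- G - Y has a large strong component for every small Y.  Then every small cut has exactly one
-- large side, so X acts as a terminal: every cut of size at most k that separates s from the large
-- side lies behind one of at most 4^k important cuts (pushed towards the large side as far as
-- possible).  Delete s, t and the ends of the important cuts seen from s and, by reversing
-- all arcs, from t.  The large component that remains contains a vertex v, and v is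
-- incident to a minimal cut of size at most k; but the important cut that dominates this cut
-- either has v strictly behind it or has v as one of its ends, a contradiction.
-- Hence every X has a balanced separator of size 2^O(k), and splitting recursively along these
-- separators gives an arboreal decomposition with 2^O(k) vertices per bag; the separator vertices
-- are stacked on a path, so that the nodes of the decomposition are the vertices of G themselves.
module Submission where

open import Defs
open import Algebra.Properties.CommutativeSemigroup using (interchange)
open import Data.Bool using (true)
open import Data.Empty using (⊥; ⊥-elim)
open import Data.Fin using (Fin; zero; suc)
open import Data.Fin.Properties using (any?; all?) renaming (_≟_ to _≟ᶠ_)
open import Data.Fin.Subset using (Subset; _∈_; _∉_; _⊆_; _⊂_; ∣_∣; _∪_; _∩_; ∁; ⁅_⁆; Nonempty; Empty; inside; outside) renaming (⊥ to ∅; ⊤ to full)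
open import Data.Fin.Subset.Properties
open import Data.Maybe using (Maybe; just; nothing)
open import Data.Nat using (ℕ; zero; suc; _+_; _*_; _^_; _∸_; _≤_; _<_; z≤n; s≤s; _≤?_)
open import Data.Nat.Induction using (<-wellFounded; Acc; acc)
open import Data.Nat.Properties
open import Data.Product using (Σ; ∃; _×_; _,_; proj₁; proj₂)
open import Data.Sum using (_⊎_; inj₁; inj₂; [_,_]′)
open import Data.Vec using ([]; _∷_; here; there; tabulate)
open import Data.Vec.Properties using (lookup∘tabulate; lookup⇒[]=; []=⇒lookup)
open import Function using (_∘_; id)
open import Relation.Nullary using (¬_; Dec; yes; no; does; ¬?)
open import Relation.Nullary.Decidable using (dec-true; decidable-stable; map′; _×-dec_)
open import Relation.Unary using (Decidable)
open import Relation.Binary.PropositionalEquality using (_≡_; _≢_; refl; sym; trans; cong; subst)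

-- Finite subsets

comprehension : ∀ {n} {P : Fin n → Set} → Decidable P → Subset n
comprehension P? = tabulate (λ x → does (P? x))

module _ {n} {P : Fin n → Set} (P? : Decidable P) where

  ∈-comprehension⁺ : ∀ {x} → P x → x ∈ comprehension P?
  ∈-comprehension⁺ {x} px =
    lookup⇒[]= x _ (trans (lookup∘tabulate _ x) (dec-true (P? x) px))

  ∈-comprehension⁻ : ∀ {x} → x ∈ comprehension P? → P x
  ∈-comprehension⁻ {x} x∈ =
    witness (P? x) (trans (sym (lookup∘tabulate _ x)) ([]=⇒lookup x∈))
    where
    witness : ∀ {A : Set} (d : Dec A) → does d ≡ true → A
    witness (yes a) _  = a
    witness (no _)  ()

∣p∪q∣+∣p∩q∣≡∣p∣+∣q∣ : ∀ {n} (p q : Subset n) → ∣ p ∪ q ∣ + ∣ p ∩ q ∣ ≡ ∣ p ∣ + ∣ q ∣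
∣p∪q∣+∣p∩q∣≡∣p∣+∣q∣ []            []            = refl
∣p∪q∣+∣p∩q∣≡∣p∣+∣q∣ (outside ∷ p) (outside ∷ q) = ∣p∪q∣+∣p∩q∣≡∣p∣+∣q∣ p q
∣p∪q∣+∣p∩q∣≡∣p∣+∣q∣ (inside  ∷ p) (outside ∷ q) = cong suc (∣p∪q∣+∣p∩q∣≡∣p∣+∣q∣ p q)
∣p∪q∣+∣p∩q∣≡∣p∣+∣q∣ (outside ∷ p) (inside  ∷ q) =
  trans (cong suc (∣p∪q∣+∣p∩q∣≡∣p∣+∣q∣ p q)) (sym (+-suc ∣ p ∣ ∣ q ∣))
∣p∪q∣+∣p∩q∣≡∣p∣+∣q∣ (inside  ∷ p) (inside  ∷ q) =
  cong suc (trans (+-suc _ _) (trans (cong suc (∣p∪q∣+∣p∩q∣≡∣p∣+∣q∣ p q)) (sym (+-suc ∣ p ∣ ∣ q ∣))))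

∣p∪q∣≤∣p∣+∣q∣ : ∀ {n} (p q : Subset n) → ∣ p ∪ q ∣ ≤ ∣ p ∣ + ∣ q ∣
∣p∪q∣≤∣p∣+∣q∣ p q = ≤-trans (m≤m+n _ _) (≤-reflexive (∣p∪q∣+∣p∩q∣≡∣p∣+∣q∣ p q))

∣p∪q∣≤ : ∀ {n} (p q : Subset n) {i j} → ∣ p ∣ ≤ i → ∣ q ∣ ≤ j → ∣ p ∪ q ∣ ≤ i + j
∣p∪q∣≤ p q p≤ q≤ = ≤-trans (∣p∪q∣≤∣p∣+∣q∣ p q) (+-mono-≤ p≤ q≤)

∪-least : ∀ {n} {p q r : Subset n} → p ⊆ r → q ⊆ r → p ∪ q ⊆ r
∪-least {p = p} {q} p⊆r q⊆r x∈ = [ p⊆r , q⊆r ]′ (x∈p∪q⁻ p q x∈)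

⁅x⁆⊆ : ∀ {n} {x : Fin n} {p} → x ∈ p → ⁅ x ⁆ ⊆ p
⁅x⁆⊆ {x = x} x∈p y∈ = subst (_∈ _) (sym (x∈⁅y⁆⇒x≡y x y∈)) x∈p

∈⇒0<∣∣ : ∀ {n} {x : Fin n} {p : Subset n} → x ∈ p → 0 < ∣ p ∣
∈⇒0<∣∣ {x = x} x∈ = ≤-trans (≤-reflexive (sym (∣⁅x⁆∣≡1 x))) (p⊆q⇒∣p∣≤∣q∣ (⁅x⁆⊆ x∈))

∣p∩∁⁅x⁆∣<∣p∣ : ∀ {n} {x : Fin n} {p : Subset n} → x ∈ p → ∣ p ∩ ∁ ⁅ x ⁆ ∣ < ∣ p ∣
∣p∩∁⁅x⁆∣<∣p∣ {x = x} {p} x∈ = p⊂q⇒∣p∣<∣q∣ (p∩q⊆p p _ , x , x∈ , λ x∈′ → x∈∁p⇒x∉p (p∩q⊆q p _ x∈′) (x∈⁅x⁆ x))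

image-cover : ∀ {m n} (f : Fin m → Fin n) (D : Subset m) →
              Σ (Subset n) λ Y → ∣ Y ∣ ≤ ∣ D ∣ × (∀ {a} → a ∈ D → f a ∈ Y)
image-cover {n = n} f [] = ∅ , ≤-reflexive (∣⊥∣≡0 n) , λ ()
image-cover f (outside ∷ D) with image-cover (f ∘ suc) D
... | Y , Y≤ , fD⊆Y = Y , Y≤ , λ { (there a∈) → fD⊆Y a∈ }
image-cover f (inside ∷ D) with image-cover (f ∘ suc) D
... | Y , Y≤ , fD⊆Y =
  ⁅ f zero ⁆ ∪ Y , ∣p∪q∣≤ ⁅ f zero ⁆ Y (≤-reflexive (∣⁅x⁆∣≡1 (f zero))) Y≤ ,
  λ { here → x∈p∪q⁺ (inj₁ (x∈⁅x⁆ (f zero))) ; (there a∈) → x∈p∪q⁺ (inj₂ (fD⊆Y a∈)) }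

minimiser : ∀ {n} {P : Subset n → Set} → Decidable P → (μ : Subset n → ℕ) → ∃ P →
            Σ (Subset n) λ R → P R × (∀ Q → P Q → μ R ≤ μ Q)
minimiser {P = P} P? μ (R₀ , p₀) = search R₀ p₀ (<-wellFounded (μ R₀))
  where
  search : ∀ R → P R → Acc _<_ (μ R) → Σ _ λ R → P R × (∀ Q → P Q → μ R ≤ μ Q)
  search R p (acc rs) with anySubset? (λ Q → P? Q ×-dec (suc (μ Q) ≤? μ R))
  ... | yes (Q , q , Q<R) = search Q q (rs Q<R)
  ... | no ¬smaller       = R , p , λ Q q → ≮⇒≥ (λ Q<R → ¬smaller (Q , q , Q<R))

∣∁p∣<∣∁q∣ : ∀ {n} {p q : Subset n} → q ⊂ p → ∣ ∁ p ∣ < ∣ ∁ q ∣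
∣∁p∣<∣∁q∣ q⊂p = p⊂q⇒∣p∣<∣q∣ (p⊂q⇒∁p⊃∁q q⊂p)

-- Saturation; each round shrinks the complement of `T`. With `P` a reachability predicate and `E`
-- its one-step relation, `T` is the set of reached vertices.
closure : ∀ {n} {P : Fin n → Set} {E : Fin n → Fin n → Set} → (∀ x → Decidable (E x)) →
          (∀ {x y} → P x → E x y → P y) → (T₀ : Subset n) → (∀ {x} → x ∈ T₀ → P x) →
          Σ (Subset n) λ T → T₀ ⊆ T × (∀ {x} → x ∈ T → P x) × (∀ {x y} → x ∈ T → E x y → y ∈ T)
closure {n} {P} {E} E? extend T₀ P₀ = grow T₀ P₀ (<-wellFounded _)
  where
  grow : ∀ T → (∀ {x} → x ∈ T → P x) → Acc _<_ ∣ ∁ T ∣ →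
         Σ (Subset n) λ T′ → T ⊆ T′ × (∀ {x} → x ∈ T′ → P x) × (∀ {x y} → x ∈ T′ → E x y → y ∈ T′)
  grow T PT (acc rs) with any? (λ x → any? (λ y → (x ∈? T) ×-dec (E? x y ×-dec ¬? (y ∈? T))))
  ... | no closed = T , id , PT , λ {x} {y} x∈ e →
      decidable-stable (y ∈? T) (λ y∉ → closed (x , y , x∈ , e , y∉))
  ... | yes (x , y , x∈ , e , y∉)
      with grow (T ∪ ⁅ y ⁆)
             (λ {z} z∈ → [ PT , (λ z∈y → subst P (sym (x∈⁅y⁆⇒x≡y y z∈y)) (extend (PT x∈) e)) ]′ (x∈p∪q⁻ T ⁅ y ⁆ z∈))
             (rs (∣∁p∣<∣∁q∣ {p = T ∪ ⁅ y ⁆} {T} (p⊆p∪q ⁅ y ⁆ , y , x∈p∪q⁺ (inj₂ (x∈⁅x⁆ y)) , y∉)))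
  ... | T′ , T⊆ , PT′ , cl = T′ , T⊆ ∘ p⊆p∪q ⁅ y ⁆ , PT′ , cl

-- Cuts seen from a large region

δ : (G : Digraph) → Subset (n G) → Subset (m G)
δ G R = comprehension (λ a → (tail G a ∈? R) ×-dec ¬? (head G a ∈? R))

-- Abstracts "more than half of `X`". `Large-meet` says that two large sets intersect; applied to a
-- set and itself, that a large set is nonempty.
record LargeSets (n : ℕ) : Set₁ where
  field
    Large      : Subset n → Set
    Large?     : Decidable Large
    Large-mono : ∀ {A B} → A ⊆ B → Large A → Large B
    Large-meet : ∀ {A B} → Large A → Large B → ¬ (A ⊆ ∁ B)

-- Stands in for strong connectivity of `K` in `G - Y`: a set whose leaving arcs all touch `Y` has
-- none in `G - Y`, so it cannot divide a strong component.
Unsplit : (G : Digraph) (Y K : Subset (n G)) → Set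
Unsplit G Y K = ∀ R → (∀ {a} → a ∈ δ G R → tail G a ∈ Y ⊎ head G a ∈ Y) → K ⊆ R ⊎ K ⊆ ∁ R

op : Digraph → Digraph
op G = record { n = n G ; m = m G ; tail = head G ; head = tail G }

module _ {G : Digraph} {R : Subset (n G)} where

  ∈δ⁺ : ∀ {a} → tail G a ∈ R → head G a ∉ R → a ∈ δ G R
  ∈δ⁺ t∈ h∉ = ∈-comprehension⁺ (λ a → (tail G a ∈? R) ×-dec ¬? (head G a ∈? R)) (t∈ , h∉)

  ∈δ⁻ : ∀ {a} → a ∈ δ G R → tail G a ∈ R × head G a ∉ R
  ∈δ⁻ = ∈-comprehension⁻ (λ a → (tail G a ∈? R) ×-dec ¬? (head G a ∈? R))

-- The arcs leaving `R` in the reversed graph are those leaving `∁ R` in `G`, so the two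
-- alternatives swap.
Unsplit-op : ∀ {G Y K} → Unsplit G Y K → Unsplit (op G) Y K
Unsplit-op {G} unsplit R touch
  with unsplit (∁ R) (λ a∈ → let t∈ , h∉ = ∈δ⁻ {G} a∈ in
                             [ inj₂ , inj₁ ]′ (touch (∈δ⁺ {op G} (x∉∁p⇒x∈p h∉) (x∈∁p⇒x∉p t∈))))
... | inj₁ K⊆ = inj₂ K⊆
... | inj₂ K⊆ = inj₁ (λ x∈ → x∉∁p⇒x∈p (x∈∁p⇒x∉p (K⊆ x∈)))

-- Every vertex of R is reachable from s inside R, stated without walks.
Connected : (G : Digraph) → Fin (n G) → Subset (n G) → Set
Connected G s R =
  ∀ U → s ∈ U → (∀ a → tail G a ∈ U → tail G a ∈ R → head G a ∈ R → head G a ∈ U) → R ⊆ U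

-- Havens and the submodular cut function.

module Havens (G : Digraph) (L : LargeSets (n G)) where
  open LargeSets L

  record Core (Y K : Subset (n G)) : Set where
    field
      large   : Large K
      avoids  : K ⊆ ∁ Y
      unsplit : Unsplit G Y K

  open Core public

  -- Cores of different sets need not be compatible; `Large-meet` makes them agree on the large side
  -- of a small cut.
  Haven : ℕ → Set
  Haven w = ∀ Y → ∣ Y ∣ ≤ w → ∃ (Core Y)

  Core-antitone : ∀ {Y Y′ K} → Y ⊆ Y′ → Core Y′ K → Core Y K
  Core-antitone Y⊆Y′ c = record
    { large   = large c
    ; avoids  = p⊆q⇒∁p⊇∁q Y⊆Y′ ∘ avoids c
    ; unsplit = λ R touch → unsplit c R (λ a∈ → [ inj₁ ∘ Y⊆Y′ , inj₂ ∘ Y⊆Y′ ]′ (touch a∈))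
    }

  -- The core lies on one side of `R`; inside `R` it would be a large set disjoint from the large
  -- set `∁ R`.
  Core-outside : ∀ {Y K R} → Core Y K → Large (∁ R) → (∀ {a} → a ∈ δ G R → tail G a ∈ Y) → K ⊆ ∁ R
  Core-outside {R = R} c out tails⊆ with unsplit c R (inj₁ ∘ tails⊆)
  ... | inj₁ K⊆R  = ⊥-elim (Large-meet (large c) out (λ x∈ → x∉p⇒x∈∁p (x∈p⇒x∉∁p (K⊆R x∈))))
  ... | inj₂ K⊆∁R = K⊆∁R

  -- `F` holds the arcs already committed to the cut, and `d F` is the cut function of `G` with `F`
  -- deleted.
  d : Subset (m G) → Subset (n G) → ℕ
  d F R = ∣ δ G R ∩ ∁ F ∣

  -- Holds arc by arc: an arc leaving the union or the intersection leaves `Q` or `R`, and an arc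
  -- leaving both leaves both `Q` and `R`.
  d-submodular : ∀ F Q R → d F (Q ∪ R) + d F (Q ∩ R) ≤ d F Q + d F R
  d-submodular F Q R = begin
    ∣ A ∣ + ∣ B ∣         ≡⟨ sym (∣p∪q∣+∣p∩q∣≡∣p∣+∣q∣ A B) ⟩
    ∣ A ∪ B ∣ + ∣ A ∩ B ∣ ≤⟨ +-mono-≤ (p⊆q⇒∣p∣≤∣q∣ A∪B⊆) (p⊆q⇒∣p∣≤∣q∣ A∩B⊆) ⟩
    ∣ C ∪ D ∣ + ∣ C ∩ D ∣ ≡⟨ ∣p∪q∣+∣p∩q∣≡∣p∣+∣q∣ C D ⟩
    ∣ C ∣ + ∣ D ∣         ∎
    where
    open ≤-Reasoning
    A = δ G (Q ∪ R) ∩ ∁ F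
    B = δ G (Q ∩ R) ∩ ∁ F
    C = δ G Q ∩ ∁ F
    D = δ G R ∩ ∁ F

    split : ∀ {P x} → x ∈ δ G P ∩ ∁ F → tail G x ∈ P × head G x ∉ P × x ∈ ∁ F
    split {P} x∈ = let x∈δ , x∉F = x∈p∩q⁻ (δ G P) (∁ F) x∈
                       t∈ , h∉   = ∈δ⁻ {G} x∈δ
                   in t∈ , h∉ , x∉F

    join : ∀ {P x} → tail G x ∈ P → head G x ∉ P → x ∈ ∁ F → x ∈ δ G P ∩ ∁ F
    join t∈ h∉ x∉F = x∈p∩q⁺ (∈δ⁺ {G} t∈ h∉ , x∉F)

    A∪B⊆ : A ∪ B ⊆ C ∪ D
    A∪B⊆ {x} x∈ with x∈p∪q⁻ A B x∈
    A∪B⊆ {x} x∈ | inj₁ x∈A with split x∈A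
    ... | t∈ , h∉ , x∉F with x∈p∪q⁻ Q R t∈
    ... | inj₁ t∈Q = x∈p∪q⁺ (inj₁ (join t∈Q (h∉ ∘ x∈p∪q⁺ ∘ inj₁) x∉F))
    ... | inj₂ t∈R = x∈p∪q⁺ (inj₂ (join t∈R (h∉ ∘ x∈p∪q⁺ ∘ inj₂) x∉F))
    A∪B⊆ {x} x∈ | inj₂ x∈B with split x∈B
    ... | t∈ , h∉ , x∉F with x∈p∩q⁻ Q R t∈ | head G x ∈? Q
    ... | t∈Q , t∈R | yes h∈Q = x∈p∪q⁺ (inj₂ (join t∈R (λ h∈R → h∉ (x∈p∩q⁺ (h∈Q , h∈R))) x∉F))
    ... | t∈Q , t∈R | no h∉Q  = x∈p∪q⁺ (inj₁ (join t∈Q h∉Q x∉F))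

    A∩B⊆ : A ∩ B ⊆ C ∩ D
    A∩B⊆ {x} x∈ with x∈p∩q⁻ A B x∈
    ... | x∈A , x∈B with split x∈A | split x∈B
    ... | _ , h∉ , x∉F | t∈ , _ , _ with x∈p∩q⁻ Q R t∈
    ... | t∈Q , t∈R =
      x∈p∩q⁺ (join t∈Q (h∉ ∘ x∈p∪q⁺ ∘ inj₁) x∉F , join t∈R (h∉ ∘ x∈p∪q⁺ ∘ inj₂) x∉F)

  ∣δ∣≤∣F∣+d : ∀ F R → ∣ δ G R ∣ ≤ ∣ F ∣ + d F R
  ∣δ∣≤∣F∣+d F R = ≤-trans (p⊆q⇒∣p∣≤∣q∣ δ⊆) (∣p∪q∣≤∣p∣+∣q∣ F _)
    where
    δ⊆ : δ G R ⊆ F ∪ (δ G R ∩ ∁ F)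
    δ⊆ {x} x∈ with x ∈? F
    ... | yes x∈F = x∈p∪q⁺ (inj₁ x∈F)
    ... | no x∉F  = x∈p∪q⁺ (inj₂ (x∈p∩q⁺ (x∈ , x∉p⇒x∈∁p x∉F)))

  d-insert-≤ : ∀ F a R → d F R ≤ suc (d (F ∪ ⁅ a ⁆) R)
  d-insert-≤ F a R =
    ≤-trans (p⊆q⇒∣p∣≤∣q∣ sub) (∣p∪q∣≤ ⁅ a ⁆ _ (≤-reflexive (∣⁅x⁆∣≡1 a)) ≤-refl)
    where
    sub : δ G R ∩ ∁ F ⊆ ⁅ a ⁆ ∪ (δ G R ∩ ∁ (F ∪ ⁅ a ⁆))
    sub {x} x∈ with x ∈? ⁅ a ⁆ | x∈p∩q⁻ (δ G R) (∁ F) x∈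
    ... | yes x∈a | _ = x∈p∪q⁺ (inj₁ x∈a)
    ... | no x∉a  | x∈δ , x∉F =
      x∈p∪q⁺ (inj₂ (x∈p∩q⁺ (x∈δ , x∉p⇒x∈∁p ([ x∈∁p⇒x∉p x∉F , x∉a ]′ ∘ x∈p∪q⁻ F ⁅ a ⁆))))

  d-insert-< : ∀ {F a R} → a ∈ δ G R → a ∉ F → d (F ∪ ⁅ a ⁆) R < d F R
  d-insert-< {F} {a} {R} a∈ a∉F = p⊂q⇒∣p∣<∣q∣ (sub , a , x∈p∩q⁺ (a∈ , x∉p⇒x∈∁p a∉F) , a∉)
    where
    sub : δ G R ∩ ∁ (F ∪ ⁅ a ⁆) ⊆ δ G R ∩ ∁ F
    sub x∈ = let x∈δ , x∉ = x∈p∩q⁻ (δ G R) (∁ (F ∪ ⁅ a ⁆)) x∈ in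
             x∈p∩q⁺ (x∈δ , p⊆q⇒∁p⊇∁q (p⊆p∪q ⁅ a ⁆) x∉)
    a∉ : a ∉ δ G R ∩ ∁ (F ∪ ⁅ a ⁆)
    a∉ a∈′ = x∈∁p⇒x∉p (proj₂ (x∈p∩q⁻ (δ G R) (∁ (F ∪ ⁅ a ⁆)) a∈′)) (x∈p∪q⁺ (inj₂ (x∈⁅x⁆ a)))

  -- The minimum cut around `S` pushed as far as possible towards the large side.
  record Pivot (S : Subset (n G)) (F : Subset (m G)) (j : ℕ) : Set where
    field
      R*      : Subset (n G)
      S⊆R*    : S ⊆ R*
      out     : Large (∁ R*)
      d≤j     : d F R* ≤ j
      least   : ∀ Q → S ⊆ Q → Large (∁ Q) → d F R* ≤ d F Q
      maximal : ∀ Q → R* ⊂ Q → Large (∁ Q) → d F R* < d F Q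

  pivot? : ∀ S F j → (∀ Q → S ⊆ Q → Large (∁ Q) → ¬ (d F Q ≤ j)) ⊎ Pivot S F j
  pivot? S F j with Large? (∁ S)
  ... | no ¬out = inj₁ (λ Q S⊆Q out _ → ¬out (Large-mono (p⊆q⇒∁p⊇∁q S⊆Q) out))
  ... | yes outS
      with minimiser (λ Q → (S ⊆? Q) ×-dec Large? (∁ Q)) μ (S , id , outS)
    where
    -- Lexicographic weight: first `d`, then the size of the complement, which stays below the
    -- factor `suc (n G)`.
    μ : Subset (n G) → ℕ
    μ Q = d F Q * suc (n G) + ∣ ∁ Q ∣
  ... | R* , (S⊆R* , out) , min = result
    where
    least : ∀ Q → S ⊆ Q → Large (∁ Q) → d F R* ≤ d F Q
    least Q S⊆Q outQ = ≮⇒≥ λ dQ<dR* → <⇒≱ (begin-strict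
      d F Q * suc (n G) + ∣ ∁ Q ∣ <⟨ +-monoʳ-< (d F Q * suc (n G)) (s≤s (∣p∣≤n (∁ Q))) ⟩
      d F Q * suc (n G) + suc (n G) ≡⟨ +-comm _ (suc (n G)) ⟩
      suc (d F Q) * suc (n G)     ≤⟨ *-monoˡ-≤ (suc (n G)) dQ<dR* ⟩
      d F R* * suc (n G)          ≤⟨ m≤m+n _ _ ⟩
      d F R* * suc (n G) + ∣ ∁ R* ∣ ∎) (min Q (S⊆Q , outQ))
      where open ≤-Reasoning

    maximal : ∀ Q → R* ⊂ Q → Large (∁ Q) → d F R* < d F Q
    maximal Q R*⊂Q outQ = ≰⇒> λ dQ≤dR* →
      <⇒≱ (+-mono-≤-< (*-monoˡ-≤ (suc (n G)) dQ≤dR*) (∣∁p∣<∣∁q∣ R*⊂Q))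
          (min Q (proj₁ R*⊂Q ∘ S⊆R* , outQ))

    result : (∀ Q → S ⊆ Q → Large (∁ Q) → ¬ (d F Q ≤ j)) ⊎ Pivot S F j
    result with d F R* ≤? j
    ... | no d≰j  = inj₁ (λ Q S⊆Q outQ dQ≤j → d≰j (≤-trans (least Q S⊆Q outQ) dQ≤j))
    ... | yes d≤j = inj₂ (record { R* = R* ; S⊆R* = S⊆R* ; out = out ; d≤j = d≤j
                                 ; least = least ; maximal = maximal })

  ends-cover : ∀ D → Σ (Subset (n G)) λ X → ∣ X ∣ ≤ ∣ D ∣ + ∣ D ∣ ×
               (∀ {a} → a ∈ D → tail G a ∈ X × head G a ∈ X)
  ends-cover D with image-cover (tail G) D | image-cover (head G) D
  ... | X , X≤ , t∈ | Y , Y≤ , h∈ =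
    X ∪ Y , ∣p∪q∣≤ X Y X≤ Y≤ , λ a∈ → x∈p∪q⁺ (inj₁ (t∈ a∈)) , x∈p∪q⁺ (inj₂ (h∈ a∈))

  -- Important cuts by bounded branching.

  module ImportantCuts {w k : ℕ} (haven : Haven w) (2k≤w : k + k ≤ w) (s : Fin (n G)) where

    -- Deleting the tails of both cuts costs at most `2k` vertices, and the remaining core lies
    -- outside `Q` and outside `R`.
    ∪-outside : ∀ {Q R} → ∣ δ G Q ∣ ≤ k → ∣ δ G R ∣ ≤ k → Large (∁ Q) → Large (∁ R) →
                Large (∁ (Q ∪ R))
    ∪-outside {Q} {R} Q≤ R≤ outQ outR
      with image-cover (tail G) (δ G Q) | image-cover (tail G) (δ G R)
    ... | X , X≤ , tQ | Y , Y≤ , tR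
      with haven (X ∪ Y) (≤-trans (∣p∪q∣≤ X Y (≤-trans X≤ Q≤) (≤-trans Y≤ R≤)) 2k≤w)
    ... | K , c = Large-mono (λ x∈ → x∉p⇒x∈∁p
        ([ x∈∁p⇒x∉p (Core-outside c outQ (x∈p∪q⁺ ∘ inj₁ ∘ tQ) x∈)
         , x∈∁p⇒x∉p (Core-outside c outR (x∈p∪q⁺ ∘ inj₂ ∘ tR) x∈) ]′ ∘ x∈p∪q⁻ Q R)) (large c)

    -- `R` is the side to be hit and stays fixed. `Q` dominates it, carries the budget and is pushed
    -- outwards by the branching; `heads` finally confines `R` to the pivot.
    record Candidate (S : Subset (n G)) (F : Subset (m G)) (j : ℕ) (R : Subset (n G)) : Set where
      field
        connected : Connected G s R
        Q         : Subset (n G)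
        R⊆Q       : R ⊆ Q
        S⊆Q       : S ⊆ Q
        outQ      : Large (∁ Q)
        dQ≤j      : d F Q ≤ j
        heads     : ∀ {a} → a ∈ F → head G a ∉ R

    Hits : Subset (n G) → Subset (n G) → Set
    Hits X R = ∀ {K} → Core X K → ∀ {a} → a ∈ δ G R → tail G a ∉ K × head G a ∉ K

    -- A branching of depth `f` has at most `2 ^ f` leaves, each giving the ends of one cut of size
    -- at most `k`.
    HittingSet : ℕ → Subset (n G) → Subset (m G) → ℕ → Set
    HittingSet f S F j =
      Σ (Subset (n G)) λ X → ∣ X ∣ ≤ 2 ^ f * (k + k) × (∀ {R} → Candidate S F j R → Hits X R)

    none : ∀ {f S F j} → (∀ Q → S ⊆ Q → Large (∁ Q) → ¬ (d F Q ≤ j)) → HittingSet f S F j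
    none ¬Q = ∅ , ≤-trans (≤-reflexive (∣⊥∣≡0 (n G))) z≤n ,
      λ c → let open Candidate c in ⊥-elim (¬Q Q S⊆Q outQ dQ≤j)

    -- The core avoids `R*`, hence every tail of `δ G R`. A head in the core would lie outside `R*`,
    -- making its arc one of `δ G R*`, whose ends are in `X`.
    Hits-superset : ∀ {X R R*} → R ⊆ R* → Large (∁ R*) →
                    (∀ {a} → a ∈ δ G R* → tail G a ∈ X × head G a ∈ X) → Hits X R
    Hits-superset {X} {R} {R*} R⊆R* out ends {K} c {a} a∈ = tail∉ , head∉
      where
      K⊆∁R* : K ⊆ ∁ R*
      K⊆∁R* = Core-outside c out (proj₁ ∘ ends)
      tail∈R* : tail G a ∈ R*
      tail∈R* = R⊆R* (proj₁ (∈δ⁻ {G} a∈))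
      tail∉ : tail G a ∉ K
      tail∉ t∈K = x∈∁p⇒x∉p (K⊆∁R* t∈K) tail∈R*
      head∉ : head G a ∉ K
      head∉ h∈K = x∈∁p⇒x∉p (avoids c h∈K)
        (proj₂ (ends (∈δ⁺ {G} tail∈R* (x∈∁p⇒x∉p (K⊆∁R* h∈K)))))

    -- All arcs leaving `R*` are in `F`, and their heads avoid every candidate `R`. As `R` is
    -- connected from `s`, it cannot leave `R*`, so the ends of `δ G R*` suffice.
    saturated : ∀ {f S F j} → s ∈ S → ∣ F ∣ + j ≤ k → (p : Pivot S F j) →
                Empty (δ G (Pivot.R* p) ∩ ∁ F) → HittingSet f S F j
    saturated {f} {S} {F} {j} s∈S F+j≤k p empty with ends-cover (δ G (Pivot.R* p))
    ... | X , X≤ , ends = X , ≤-trans X≤ bound , λ c → Hits-superset (R⊆R* c) out ends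
      where
      open Pivot p
      δ≤k : ∣ δ G R* ∣ ≤ k
      δ≤k = ≤-trans (∣δ∣≤∣F∣+d F R*) (≤-trans (+-monoʳ-≤ ∣ F ∣ d≤j) F+j≤k)
      bound : ∣ δ G R* ∣ + ∣ δ G R* ∣ ≤ 2 ^ f * (k + k)
      bound = ≤-trans (+-mono-≤ δ≤k δ≤k) (m≤n*m (k + k) (2 ^ f) {{m^n≢0 2 f}})
      R⊆R* : ∀ {R} → Candidate S F j R → R ⊆ R*
      R⊆R* {R} c = connected R* (S⊆R* s∈S) closed
        where
        open Candidate c
        closed : ∀ a → tail G a ∈ R* → tail G a ∈ R → head G a ∈ R → head G a ∈ R*
        closed a t∈R* _ h∈R with head G a ∈? R* | a ∈? F
        ... | yes h∈R* | _      = h∈R*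
        ... | no _     | yes a∈F = ⊥-elim (heads a∈F h∈R)
        ... | no h∉R*  | no a∉F  =
          ⊥-elim (empty (a , x∈p∩q⁺ (∈δ⁺ {G} t∈R* h∉R* , x∉p⇒x∈∁p a∉F)))

    -- Uncrossing a candidate with the pivot R* keeps its value; then the arc a of δ R* is
    -- either still cut (its removal lowers the budget) or its head joins the source side
    -- (which raises the minimum, R* being the largest minimiser).
    branch : ∀ {f S F j} → ∣ F ∣ + suc j ≤ k → (p : Pivot S F (suc j)) → let open Pivot p in
             ∀ {a} → a ∈ δ G R* ∩ ∁ F →
             HittingSet f R* (F ∪ ⁅ a ⁆) j → HittingSet f (R* ∪ ⁅ head G a ⁆) F (suc j) →
             HittingSet (suc f) S F (suc j)
    branch {f} {S} {F} {j} F+j≤k p {a} a∈ (X₁ , X₁≤ , hits₁) (X₂ , X₂≤ , hits₂) =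
      X₁ ∪ X₂ , bound , hits
      where
      open Pivot p
      bound : ∣ X₁ ∪ X₂ ∣ ≤ 2 ^ suc f * (k + k)
      bound = ≤-trans (∣p∪q∣≤ X₁ X₂ X₁≤ X₂≤) (≤-reflexive
        (trans (sym (*-distribʳ-+ (k + k) (2 ^ f) (2 ^ f)))
               (cong (λ e → (2 ^ f + e) * (k + k)) (sym (+-identityʳ (2 ^ f))))))
      a∈δ : a ∈ δ G R*
      a∈δ = proj₁ (x∈p∩q⁻ (δ G R*) (∁ F) a∈)
      a∉F : a ∉ F
      a∉F = x∈∁p⇒x∉p (proj₂ (x∈p∩q⁻ (δ G R*) (∁ F) a∈))

      δ≤k : ∀ {Q} → d F Q ≤ suc j → ∣ δ G Q ∣ ≤ k
      δ≤k {Q} dQ≤ = ≤-trans (∣δ∣≤∣F∣+d F Q) (≤-trans (+-monoʳ-≤ ∣ F ∣ dQ≤) F+j≤k)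

      hits : ∀ {R} → Candidate S F (suc j) R → Hits (X₁ ∪ X₂) R
      hits {R} c = result
        where
        open Candidate c
        Q′ : Subset (n G)
        Q′ = Q ∪ R*
        outQ′ : Large (∁ Q′)
        outQ′ = ∪-outside (δ≤k dQ≤j) (δ≤k d≤j) outQ out
        dQ′≤ : d F Q′ ≤ suc j
        -- `Q ∩ R*` still contains `S`, so its value is at least that of `R*`; submodularity then
        -- bounds the union by `d F Q`.
        dQ′≤ = ≤-trans (+-cancelʳ-≤ (d F R*) _ _ (≤-trans
          (+-monoʳ-≤ (d F Q′) (least (Q ∩ R*) (λ x∈ → x∈p∩q⁺ (S⊆Q x∈ , S⊆R* x∈))
                                (Large-mono (p⊆q⇒∁p⊇∁q (p∩q⊆p Q R*)) outQ)))
          (d-submodular F Q R*))) dQ≤j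
        result : Hits (X₁ ∪ X₂) R
        result c with head G a ∈? Q′
        ... | yes h∈ = hits₂ (record
          { connected = connected ; Q = Q′ ; R⊆Q = p⊆p∪q R* ∘ R⊆Q
          ; S⊆Q = ∪-least (q⊆p∪q Q R*) (⁅x⁆⊆ h∈) ; outQ = outQ′ ; dQ≤j = dQ′≤ ; heads = heads })
          (Core-antitone (q⊆p∪q X₁ X₂) c)
        -- Here `a` leaves `Q′`, so committing it saves one unit of budget, and its head is outside
        -- `R`.
        ... | no h∉ = hits₁ (record
          { connected = connected ; Q = Q′ ; R⊆Q = p⊆p∪q R* ∘ R⊆Q
          ; S⊆Q = q⊆p∪q Q R* ; outQ = outQ′
          ; dQ≤j = ≤-pred (≤-trans (d-insert-< (∈δ⁺ {G} (q⊆p∪q Q R* (proj₁ (∈δ⁻ {G} a∈δ))) h∉) a∉F) dQ′≤)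
          ; heads = λ {b} b∈ → [ heads , (λ b∈a → subst (λ b → head G b ∉ R) (sym (x∈⁅y⁆⇒x≡y a b∈a))
                                                    (h∉ ∘ p⊆p∪q R* ∘ R⊆Q)) ]′ (x∈p∪q⁻ F ⁅ a ⁆ b∈) })
          (Core-antitone (p⊆p∪q X₂) c)

    -- The measure, bounded by `f`, is `2j` minus the least `d F Q`. Committing `a` lowers `2j` by
    -- two and the minimum by at most one; adding the head of `a` goes strictly beyond the largest
    -- minimiser, which raises the minimum.
    hittingSet : ∀ f S F j → s ∈ S → ∣ F ∣ + j ≤ k →
                 (∀ Q → S ⊆ Q → Large (∁ Q) → j + j ≤ f + d F Q) → HittingSet f S F j
    hittingSet f S F j s∈S F+j≤k fuel with pivot? S F j
    ... | inj₁ ¬Q = none {f} ¬Q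
    ... | inj₂ p with nonempty? (δ G (Pivot.R* p) ∩ ∁ F)
    ... | no empty = saturated {f} s∈S F+j≤k p empty
    hittingSet f S F zero s∈S F+j≤k fuel | inj₂ p | yes (a , a∈) =
      ⊥-elim (<⇒≱ (∈⇒0<∣∣ a∈) (Pivot.d≤j p))
    -- Without fuel the minimum is at least twice `suc j`, more than the pivot attains.
    hittingSet zero S F (suc j) s∈S F+j≤k fuel | inj₂ p | yes (a , a∈) =
      ⊥-elim (<⇒≱ (m<m+n (suc j) (s≤s z≤n)) (≤-trans (fuel R* S⊆R* out) d≤j))
      where open Pivot p
    hittingSet (suc f) S F (suc j) s∈S F+j≤k fuel | inj₂ p | yes (a , a∈) =
      branch {f} F+j≤k p a∈
        (hittingSet f R* (F ∪ ⁅ a ⁆) j (S⊆R* s∈S) budget₁ fuel₁)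
        (hittingSet f (R* ∪ ⁅ head G a ⁆) F (suc j) (p⊆p∪q _ (S⊆R* s∈S)) F+j≤k fuel₂)
      where
      open Pivot p
      open ≤-Reasoning
      budget₁ : ∣ F ∪ ⁅ a ⁆ ∣ + j ≤ k
      budget₁ = begin
        ∣ F ∪ ⁅ a ⁆ ∣ + j ≤⟨ +-monoˡ-≤ j (∣p∪q∣≤ F ⁅ a ⁆ ≤-refl (≤-reflexive (∣⁅x⁆∣≡1 a))) ⟩
        ∣ F ∣ + 1 + j     ≡⟨ +-assoc ∣ F ∣ 1 j ⟩
        ∣ F ∣ + suc j     ≤⟨ F+j≤k ⟩
        k                 ∎
      fuel₁ : ∀ Q → R* ⊆ Q → Large (∁ Q) → j + j ≤ f + d (F ∪ ⁅ a ⁆) Q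
      fuel₁ Q R*⊆Q outQ = ≤-pred (≤-pred (begin
        suc (suc (j + j))               ≡⟨ cong suc (sym (+-suc j j)) ⟩
        suc j + suc j                   ≤⟨ fuel Q (R*⊆Q ∘ S⊆R*) outQ ⟩
        suc f + d F Q                   ≤⟨ +-monoʳ-≤ (suc f) (d-insert-≤ F a Q) ⟩
        suc f + suc (d (F ∪ ⁅ a ⁆) Q)   ≡⟨ cong suc (+-suc f _) ⟩
        suc (suc (f + d (F ∪ ⁅ a ⁆) Q)) ∎))
      fuel₂ : ∀ Q → R* ∪ ⁅ head G a ⁆ ⊆ Q → Large (∁ Q) → suc j + suc j ≤ f + d F Q
      fuel₂ Q sub outQ = begin
        suc j + suc j    ≤⟨ fuel R* S⊆R* out ⟩
        suc f + d F R*   ≡⟨ sym (+-suc f _) ⟩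
        f + suc (d F R*) ≤⟨ +-monoʳ-≤ f (maximal Q (sub ∘ p⊆p∪q _ , head G a , sub (q⊆p∪q R* _ (x∈⁅x⁆ _)) , h∉) outQ) ⟩
        f + d F Q        ∎
        where
        h∉ : head G a ∉ R*
        h∉ = proj₂ (∈δ⁻ {G} (proj₁ (x∈p∩q⁻ (δ G R*) (∁ F) a∈)))

    -- The search starts at `⁅ s ⁆` with no committed arc, budget `k` and fuel `2k`; each `R` is its
    -- own dominating set.
    importantEnds : Σ (Subset (n G)) λ X → ∣ X ∣ ≤ 2 ^ (k + k) * (k + k) ×
                    (∀ {R} → s ∈ R → Connected G s R → Large (∁ R) → ∣ δ G R ∣ ≤ k → Hits X R)
    importantEnds
      with hittingSet (k + k) ⁅ s ⁆ ∅ k (x∈⁅x⁆ s) (≤-reflexive (cong (_+ k) (∣⊥∣≡0 (m G))))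
                      (λ _ _ _ → m≤m+n _ _)
    ... | X , X≤ , hits = X , X≤ , λ {R} s∈R conn out δ≤k → hits (record
      { connected = conn ; Q = R ; R⊆Q = id ; S⊆Q = ⁅x⁆⊆ s∈R ; outQ = out
      ; dQ≤j = ≤-trans (∣p∩q∣≤∣p∣ (δ G R) (∁ ∅)) δ≤k ; heads = λ a∈ → ⊥-elim (∉⊥ a∈) })

-- Minimal cuts

Reach-snoc : ∀ {G C u v} → ReachAvoidingArcs G C u v → ∀ a → a ∉ C → tail G a ≡ v →
             ReachAvoidingArcs G C u (head G a)
Reach-snoc here             a a∉ refl = step a a∉ refl here
Reach-snoc (step b b∉ eq r) a a∉ ta   = step b b∉ eq (Reach-snoc r a a∉ ta)

Reach-++ : ∀ {G C u v w} → ReachAvoidingArcs G C u v → ReachAvoidingArcs G C v w →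
           ReachAvoidingArcs G C u w
Reach-++ here             q = q
Reach-++ (step a a∉ eq p) q = step a a∉ eq (Reach-++ p q)

Reach-op : ∀ {G C u v} → ReachAvoidingArcs G C u v → ReachAvoidingArcs (op G) C v u
Reach-op here              = here
Reach-op (step a a∉ refl p) = Reach-snoc (Reach-op p) a a∉ refl

IsMinimalCut-op : ∀ {G s t C} → IsMinimalCut G s t C → IsMinimalCut (op G) t s C
IsMinimalCut-op (cut , minimal) =
  cut ∘ Reach-op , λ C′ C′⊆C cut′ → minimal C′ C′⊆C (cut′ ∘ Reach-op)

record CutSide (G : Digraph) (s : Fin (n G)) (C : Subset (m G)) : Set where
  field
    R         : Subset (n G)
    s∈R       : s ∈ R
    reach     : ∀ {v} → v ∈ R → ReachAvoidingArcs G C s v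
    C⊆δR      : C ⊆ δ G R
    δR⊆C      : δ G R ⊆ C
    connected : Connected G s R

-- Take the vertices reachable from `s` without `C`. The arcs leaving them lie in `C` and already
-- form a cut, so minimality gives equality.
minimalCut-side : ∀ {G s t C} → IsMinimalCut G s t C → CutSide G s C
minimalCut-side {G} {s} {t} {C} (cut , minimal)
  with closure {P = ReachAvoidingArcs G C s}
         {E = λ x y → Σ (Fin (m G)) λ a → a ∉ C × tail G a ≡ x × head G a ≡ y}
         (λ x y → any? (λ a → ¬? (a ∈? C) ×-dec ((tail G a ≟ᶠ x) ×-dec (head G a ≟ᶠ y))))
         (λ { r (a , a∉ , ta , refl) → Reach-snoc r a a∉ ta })
         ⁅ s ⁆ (λ x∈ → subst (ReachAvoidingArcs G C s) (sym (x∈⁅y⁆⇒x≡y s x∈)) here)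
... | R , s⊆R , reach , closed = record
  { R = R ; s∈R = s∈R ; reach = reach ; C⊆δR = C⊆δR ; δR⊆C = δR⊆C ; connected = connected }
  where
  s∈R : s ∈ R
  s∈R = s⊆R (x∈⁅x⁆ s)

  δR⊆C : δ G R ⊆ C
  δR⊆C {a} a∈ with a ∈? C
  ... | yes a∈C = a∈C
  ... | no a∉C  = let t∈ , h∉ = ∈δ⁻ {G} a∈ in ⊥-elim (h∉ (closed t∈ (a , a∉C , refl , refl)))

  stays : ∀ {u v} → u ∈ R → ReachAvoidingArcs G (δ G R) u v → v ∈ R
  stays u∈ here = u∈
  stays u∈ (step a a∉ refl r) with head G a ∈? R
  ... | yes h∈ = stays h∈ r
  ... | no h∉  = ⊥-elim (a∉ (∈δ⁺ {G} u∈ h∉))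

  C⊆δR : C ⊆ δ G R
  C⊆δR = minimal (δ G R) δR⊆C (λ r → cut (reach (stays s∈R r)))

  connected : Connected G s R
  connected U s∈U cl v∈ = follow s∈R s∈U (reach v∈)
    where
    follow : ∀ {u v} → u ∈ R → u ∈ U → ReachAvoidingArcs G C u v → v ∈ U
    follow u∈R u∈U here = u∈U
    follow u∈R u∈U (step a a∉ refl r) = follow h∈R (cl a u∈U u∈R h∈R) r
      where
      h∈R : head G a ∈ R
      h∈R = closed u∈R (a , a∉ , refl , refl)

-- Cut-minimal graphs have no haven of large order.

havenOrder : ℕ → ℕ
-- Two for `s` and `t`, then the ends of the important cuts seen from `s` and from `t`.
havenOrder k = 2 + (2 ^ (k + k) * (k + k) + 2 ^ (k + k) * (k + k))

kCutMinimal⇒¬Haven : ∀ {k G} → KCutMinimal k G → (L : LargeSets (n G)) →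
                     ¬ Havens.Haven G L (havenOrder k)
kCutMinimal⇒¬Haven {k} {G} (s , t , _ , cuts) L haven = result
  where
  open LargeSets L
  open Havens G L
  module Op = Havens (op G) L

  Core-op : ∀ {Y K} → Core Y K → Op.Core Y K
  Core-op c = record { large = large c ; avoids = avoids c ; unsplit = Unsplit-op {G} (unsplit c) }

  haven-op : Op.Haven (havenOrder k)
  haven-op Y Y≤ = let K , c = haven Y Y≤ in K , Core-op c

  2k≤ : k + k ≤ havenOrder k
  2k≤ = ≤-trans (m≤n*m (k + k) (2 ^ (k + k)) {{m^n≢0 2 (k + k)}})
          (≤-trans (m≤m+n _ _) (m≤n+m _ 2))

  result : ⊥
  result
    with ImportantCuts.importantEnds haven 2k≤ s | Op.ImportantCuts.importantEnds haven-op 2k≤ t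
  ... | X₁ , X₁≤ , hits₁ | X₂ , X₂≤ , hits₂
    with haven ((⁅ s ⁆ ∪ ⁅ t ⁆) ∪ (X₁ ∪ X₂))
           (∣p∪q∣≤ (⁅ s ⁆ ∪ ⁅ t ⁆) (X₁ ∪ X₂)
             (∣p∪q∣≤ ⁅ s ⁆ ⁅ t ⁆ (≤-reflexive (∣⁅x⁆∣≡1 s)) (≤-reflexive (∣⁅x⁆∣≡1 t)))
             (∣p∪q∣≤ X₁ X₂ X₁≤ X₂≤))
  ... | K , core = nonemptyCase (nonempty? K)
    where
    Y : Subset (n G)
    Y = (⁅ s ⁆ ∪ ⁅ t ⁆) ∪ (X₁ ∪ X₂)

    ≢-end : ∀ {v x} → v ∈ K → x ∈ Y → v ≢ x
    ≢-end v∈K x∈Y refl = x∈∁p⇒x∉p (avoids core v∈K) x∈Y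

    not-incident : ∀ {v a} → v ∈ K → Incident G a v → tail G a ∉ K → head G a ∉ K → ⊥
    not-incident v∈K (inj₁ refl) t∉ h∉ = t∉ v∈K
    not-incident v∈K (inj₂ refl) t∉ h∉ = h∉ v∈K

    nonemptyCase : Dec (Nonempty K) → ⊥
    nonemptyCase (no empty) =
      Large-meet (large core) (large core) (λ x∈ → ⊥-elim (empty (_ , x∈)))
    nonemptyCase (yes (v , v∈K))
      with cuts v (≢-end v∈K (x∈p∪q⁺ (inj₁ (x∈p∪q⁺ (inj₁ (x∈⁅x⁆ s))))))
                  (≢-end v∈K (x∈p∪q⁺ (inj₁ (x∈p∪q⁺ (inj₂ (x∈⁅x⁆ t))))))
    ... | a , inc , C , minimal , a∈C , C≤k
      with minimalCut-side {G} minimal | minimalCut-side {op G} (IsMinimalCut-op {G} minimal)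
    ... | left | right = side
      where
      module A = CutSide left
      module B = CutSide right

      side : ⊥
      -- The core left after deleting the tails of the cut tells which side is large: outside `A.R`
      -- the cuts seen from `s` apply, inside it those seen from `t`.
      side with image-cover (tail G) (δ G A.R)
      ... | T , T≤ , tails
        with haven T (≤-trans T≤ (≤-trans (p⊆q⇒∣p∣≤∣q∣ A.δR⊆C) (≤-trans C≤k (≤-trans (m≤m+n k k) 2k≤))))
      ... | K′ , core′ with unsplit core′ A.R (inj₁ ∘ tails)
      ... | inj₂ K′⊆ =
        let t∉ , h∉ = hits₁ A.s∈R A.connected (Large-mono K′⊆ (large core′))
                        (≤-trans (p⊆q⇒∣p∣≤∣q∣ A.δR⊆C) C≤k)
                        (Core-antitone (q⊆p∪q _ _ ∘ p⊆p∪q X₂) core) (A.C⊆δR a∈C)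
        in not-incident v∈K inc t∉ h∉
      ... | inj₁ K′⊆ =
        let h∉ , t∉ = hits₂ B.s∈R B.connected (Large-mono (R⊆ ∘ K′⊆) (large core′))
                        (≤-trans (p⊆q⇒∣p∣≤∣q∣ B.δR⊆C) C≤k)
                        (Core-op (Core-antitone (q⊆p∪q _ _ ∘ q⊆p∪q X₁ X₂) core)) (B.C⊆δR a∈C)
        in not-incident v∈K inc t∉ h∉
        where
        R⊆ : A.R ⊆ ∁ B.R
        -- A common vertex would give a path from `s` to `t` avoiding `C`.
        R⊆ x∈A = x∉p⇒x∈∁p (λ x∈B → proj₁ minimal (Reach-++ (A.reach x∈A) (Reach-op (B.reach x∈B))))

-- Strong components

module _ {G : Digraph} where

  Walk-start : ∀ {X u v} → WalkAvoiding G X u v → u ∉ X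
  Walk-start (here u∉)       = u∉
  Walk-start (step _ u∉ _ _) = u∉

  Walk-end : ∀ {X u v} → WalkAvoiding G X u v → v ∉ X
  Walk-end (here u∉)      = u∉
  Walk-end (step _ _ _ p) = Walk-end p

  Walk-++ : ∀ {X u v w} → WalkAvoiding G X u v → WalkAvoiding G X v w → WalkAvoiding G X u w
  Walk-++ (here _)         q = q
  Walk-++ (step a u∉ eq p) q = step a u∉ eq (Walk-++ p q)

  Walk-antitone : ∀ {X Y u v} → X ⊆ Y → WalkAvoiding G Y u v → WalkAvoiding G X u v
  Walk-antitone X⊆Y (here u∉)        = here (u∉ ∘ X⊆Y)
  Walk-antitone X⊆Y (step a u∉ eq p) = step a (u∉ ∘ X⊆Y) eq (Walk-antitone X⊆Y p)

  walk? : ∀ X u v → Dec (WalkAvoiding G X u v)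
  walk? X u v with u ∈? X
  ... | yes u∈ = no (λ p → Walk-start p u∈)
  ... | no u∉
      with closure {P = WalkAvoiding G X u}
             {E = λ x y → y ∉ X × Σ (Fin (m G)) λ a → tail G a ≡ x × head G a ≡ y}
             (λ x y → ¬? (y ∈? X) ×-dec any? (λ a → (tail G a ≟ᶠ x) ×-dec (head G a ≟ᶠ y)))
             (λ { p (y∉ , a , refl , refl) → Walk-++ p (step a (Walk-end p) refl (here y∉)) })
             ⁅ u ⁆ (λ x∈ → subst (WalkAvoiding G X u) (sym (x∈⁅y⁆⇒x≡y u x∈)) (here u∉))
  ... | T , u⊆T , reach , closed = map′ reach (stays (u⊆T (x∈⁅x⁆ u))) (v ∈? T)
    where
    stays : ∀ {x y} → x ∈ T → WalkAvoiding G X x y → y ∈ T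
    stays x∈ (here _)          = x∈
    stays x∈ (step a _ refl p) = stays (closed x∈ (Walk-start p , a , refl , refl)) p

-- Empty for `z` in `X`, since no walk starts there; quantifying over all `z` therefore adds only
-- the empty set to the strong components.
comp : (G : Digraph) → Subset (n G) → Fin (n G) → Subset (n G)
comp G X z = comprehension (λ v → walk? {G} X z v ×-dec walk? {G} X v z)

module _ {G : Digraph} where

  ∈comp⁺ : ∀ {X z v} → WalkAvoiding G X z v → WalkAvoiding G X v z → v ∈ comp G X z
  ∈comp⁺ {X} {z} p q = ∈-comprehension⁺ (λ v → walk? {G} X z v ×-dec walk? {G} X v z) (p , q)

  ∈comp⁻ : ∀ {X z v} → v ∈ comp G X z → WalkAvoiding G X z v × WalkAvoiding G X v z
  ∈comp⁻ {X} {z} = ∈-comprehension⁻ (λ v → walk? {G} X z v ×-dec walk? {G} X v z)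

  comp-refl : ∀ {X z} → z ∉ X → z ∈ comp G X z
  comp-refl z∉ = ∈comp⁺ (here z∉) (here z∉)

  comp-sym-trans : ∀ {X z u v} → v ∈ comp G X z → v ∈ comp G X u → u ∈ comp G X z
  comp-sym-trans v∈z v∈u =
    let p , q = ∈comp⁻ v∈z
        r , t = ∈comp⁻ v∈u
    in ∈comp⁺ (Walk-++ p t) (Walk-++ r q)

  comp-antitone : ∀ {X Y z} → X ⊆ Y → comp G Y z ⊆ comp G X z
  comp-antitone X⊆Y v∈ =
    let p , q = ∈comp⁻ v∈ in ∈comp⁺ (Walk-antitone X⊆Y p) (Walk-antitone X⊆Y q)

  comp-avoids : ∀ {X z v} → v ∈ comp G X z → v ∉ X
  comp-avoids v∈ = Walk-end (proj₁ (∈comp⁻ v∈))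

  -- A walk avoiding `X` cannot use an arc that touches `X`: if `z` is in `R`, walks from `z` stay
  -- inside; otherwise walks to `z` stay outside.
  comp-unsplit : ∀ X z → Unsplit G X (comp G X z)
  comp-unsplit X z R touch with z ∈? R
  ... | yes z∈ = inj₁ (λ v∈ → stays z∈ (proj₁ (∈comp⁻ v∈)))
    where
    stays : ∀ {u v} → u ∈ R → WalkAvoiding G X u v → v ∈ R
    stays u∈ (here _) = u∈
    stays u∈ (step a u∉X refl p) with head G a ∈? R
    ... | yes h∈ = stays h∈ p
    ... | no h∉  = ⊥-elim ([ u∉X , Walk-start p ]′ (touch (∈δ⁺ {G} u∈ h∉)))
  ... | no z∉ = inj₂ (λ v∈ → x∉p⇒x∈∁p (stays (proj₂ (∈comp⁻ v∈))))
    where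
    stays : ∀ {v} → WalkAvoiding G X v z → v ∉ R
    stays (here _) = z∉
    stays (step a u∉X refl p) u∈ =
      [ u∉X , Walk-start p ]′ (touch (∈δ⁺ {G} u∈ (stays p)))

-- Majorities and balanced separators.

majority : ∀ {n} → Subset n → LargeSets n
majority {n} X = record
  { Large      = λ A → ∣ X ∣ < ∣ X ∩ A ∣ + ∣ X ∩ A ∣
  ; Large?     = λ A → suc ∣ X ∣ ≤? ∣ X ∩ A ∣ + ∣ X ∩ A ∣
  ; Large-mono = λ {A} {B} A⊆B large →
      let X∩A≤ = p⊆q⇒∣p∣≤∣q∣ (X∩-mono A B A⊆B) in ≤-trans large (+-mono-≤ X∩A≤ X∩A≤)
  ; Large-meet = λ {A} {B} → meet A B
  }
  where
  X∩-mono : ∀ A B → A ⊆ B → X ∩ A ⊆ X ∩ B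
  X∩-mono A B A⊆B x∈ = let x∈X , x∈A = x∈p∩q⁻ X A x∈ in x∈p∩q⁺ (x∈X , A⊆B x∈A)

  meet : ∀ A B → ∣ X ∣ < ∣ X ∩ A ∣ + ∣ X ∩ A ∣ → ∣ X ∣ < ∣ X ∩ B ∣ + ∣ X ∩ B ∣ → ¬ (A ⊆ ∁ B)
  meet A B largeA largeB A⊆∁B = n≮n (∣ X ∣ + ∣ X ∣) (begin-strict
    ∣ X ∣ + ∣ X ∣         <⟨ +-mono-< largeA largeB ⟩
    (a + a) + (b + b)     ≡⟨ interchange +-commutativeSemigroup a a b b ⟩
    (a + b) + (a + b)     ≤⟨ +-mono-≤ a+b≤X a+b≤X ⟩
    ∣ X ∣ + ∣ X ∣         ∎)
    where
    open ≤-Reasoning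
    a b : ℕ
    a = ∣ X ∩ A ∣
    b = ∣ X ∩ B ∣
    disjoint : Empty ((X ∩ A) ∩ (X ∩ B))
    disjoint (x , x∈) =
      let x∈XA , x∈XB = x∈p∩q⁻ (X ∩ A) (X ∩ B) x∈ in
      x∈∁p⇒x∉p (A⊆∁B (p∩q⊆q X A x∈XA)) (p∩q⊆q X B x∈XB)
    a+b≤X : a + b ≤ ∣ X ∣
    a+b≤X = begin
      a + b ≡⟨ sym (∣p∪q∣+∣p∩q∣≡∣p∣+∣q∣ (X ∩ A) (X ∩ B)) ⟩
      ∣ (X ∩ A) ∪ (X ∩ B) ∣ + ∣ (X ∩ A) ∩ (X ∩ B) ∣
        ≡⟨ cong (∣ (X ∩ A) ∪ (X ∩ B) ∣ +_) (trans (cong ∣_∣ (Empty-unique disjoint)) (∣⊥∣≡0 n)) ⟩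
      ∣ (X ∩ A) ∪ (X ∩ B) ∣ + 0 ≡⟨ +-identityʳ _ ⟩
      ∣ (X ∩ A) ∪ (X ∩ B) ∣ ≤⟨ p⊆q⇒∣p∣≤∣q∣ (∪-least (p∩q⊆p X A) (p∩q⊆p X B)) ⟩
      ∣ X ∣ ∎

Balances : (G : Digraph) (X Y : Subset (n G)) → Set
Balances G X Y = ∀ z → ∣ X ∩ comp G Y z ∣ + ∣ X ∩ comp G Y z ∣ ≤ ∣ X ∣

-- If no small set balances `X`, each small `Y` leaves a component with more than half of `X`, and
-- these components are the cores of a haven.
balanced-separator : ∀ {G w} → (∀ L → ¬ Havens.Haven G L w) →
                     ∀ X → Σ (Subset (n G)) λ Y → ∣ Y ∣ ≤ w × Balances G X Y
balanced-separator {G} {w} noHaven X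
  with anySubset? (λ Y → (∣ Y ∣ ≤? w) ×-dec
         all? (λ z → ∣ X ∩ comp G Y z ∣ + ∣ X ∩ comp G Y z ∣ ≤? ∣ X ∣))
... | yes found = found
... | no unbalanced = ⊥-elim (noHaven (majority X) haven)
  where
  haven : Havens.Haven G (majority X) w
  haven Y Y≤w with any? (λ z → suc ∣ X ∣ ≤? ∣ X ∩ comp G Y z ∣ + ∣ X ∩ comp G Y z ∣)
  ... | yes (z , large) = comp G Y z , record
    { large = large ; avoids = λ v∈ → x∉p⇒x∈∁p (comp-avoids v∈) ; unsplit = comp-unsplit Y z }
  ... | no ¬large = ⊥-elim (unbalanced (Y , Y≤w , λ z → ≮⇒≥ (λ large → ¬large (z , large))))

-- Guarded sets.

Guarded-resp : ∀ {G X} {P Q : Fin (n G) → Set} → (∀ {v} → P v → Q v) → (∀ {v} → Q v → P v) →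
               Guarded G X P → Guarded G X Q
Guarded-resp P⇒Q Q⇒P (avoid , noReturn) =
  (λ v q → avoid v (Q⇒P q)) ,
  (λ u z w qu ¬qz qw → noReturn u z w (Q⇒P qu) (¬qz ∘ P⇒Q) (Q⇒P qw))

module _ {G : Digraph} where

  -- A walk avoiding `y` that leaves `Z ∩ ∁ ⁅ y ⁆` also leaves `Z`, so `X` already prevents its
  -- return.
  Guarded-remove : ∀ {X Z} y → Guarded G X (_∈ Z) → Guarded G (X ∪ ⁅ y ⁆) (_∈ Z ∩ ∁ ⁅ y ⁆)
  Guarded-remove {X} {Z} y (avoid , noReturn) =
    (λ v v∈ → [ avoid v (p∩q⊆p Z _ v∈) , x∈∁p⇒x∉p (p∩q⊆q Z _ v∈) ]′ ∘ x∈p∪q⁻ X ⁅ y ⁆) ,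
    (λ u z w u∈ z∉ w∈ p q → noReturn u z w (p∩q⊆p Z _ u∈)
      (λ z∈Z → z∉ (x∈p∩q⁺ (z∈Z , x∉p⇒x∈∁p (Walk-end p ∘ q⊆p∪q X _))))
      (p∩q⊆p Z _ w∈) (Walk-antitone (p⊆p∪q _) p) (Walk-antitone (p⊆p∪q _) q))

  Closed : Subset (n G) → Subset (n G) → Set
  Closed X Z = ∀ {u} → u ∈ Z → comp G X u ⊆ Z

  -- A component meeting `Z` but not inside it would leave and re-enter `Z` while avoiding `X`.
  Guarded⇒Closed : ∀ {X Y Z} → X ⊆ Y → Guarded G X (_∈ Z) → Closed Y Z
  Guarded⇒Closed {Z = Z} X⊆Y (_ , noReturn) {u} u∈ {v} v∈ with v ∈? Z
  ... | yes v∈Z = v∈Z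
  ... | no v∉Z  = let p , q = ∈comp⁻ (comp-antitone X⊆Y v∈) in ⊥-elim (noReturn u v u u∈ v∉Z u∈ p q)

  -- A walk avoiding Y that leaves and re-enters the component stays in the component of G - Y,
  -- where the smaller guard already contains every vertex of X.
  comp-guarded : ∀ X Y z → Guarded G ((X ∩ comp G Y z) ∪ Y) (_∈ comp G (X ∪ Y) z)
  comp-guarded X Y z =
    (λ v v∈ → comp-avoids v∈ ∘ ∪-least (p⊆p∪q Y ∘ p∩q⊆p X _) (q⊆p∪q X Y)) ,
    (λ u x w u∈ x∉ w∈ p q →
      let z⇝u , _ = ∈comp⁻ u∈
          _ , w⇝z = ∈comp⁻ w∈
          p′ = weaken (Walk-antitone (q⊆p∪q X Y) z⇝u) p
                 (Walk-++ (Walk-antitone (q⊆p∪q _ Y) q) (Walk-antitone (q⊆p∪q X Y) w⇝z))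
          q′ = weaken (Walk-++ (Walk-antitone (q⊆p∪q X Y) z⇝u) (Walk-antitone (q⊆p∪q _ Y) p)) q
                 (Walk-antitone (q⊆p∪q X Y) w⇝z)
      in x∉ (∈comp⁺ (Walk-++ z⇝u p′) (Walk-++ q′ w⇝z)))
    where
    outside-X∪Y : ∀ {u} → u ∉ (X ∩ comp G Y z) ∪ Y → WalkAvoiding G Y z u → WalkAvoiding G Y u z →
                  u ∉ X ∪ Y
    outside-X∪Y u∉ z⇝u u⇝z =
      [ (λ u∈X → u∉ (x∈p∪q⁺ (inj₁ (x∈p∩q⁺ (u∈X , ∈comp⁺ z⇝u u⇝z))))) , u∉ ∘ x∈p∪q⁺ ∘ inj₂ ]′ ∘ x∈p∪q⁻ X Y

    weaken : ∀ {u v} → WalkAvoiding G Y z u → WalkAvoiding G ((X ∩ comp G Y z) ∪ Y) u v →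
             WalkAvoiding G Y v z → WalkAvoiding G (X ∪ Y) u v
    weaken z⇝u (here u∉) u⇝z = here (outside-X∪Y u∉ z⇝u u⇝z)
    weaken z⇝u w@(step a u∉ refl p) v⇝z =
      step a (outside-X∪Y u∉ z⇝u (Walk-++ (Walk-antitone (q⊆p∪q _ Y) w) v⇝z)) refl
        (weaken (Walk-++ z⇝u (step a (Walk-end z⇝u) refl (here (Walk-start (Walk-antitone (q⊆p∪q _ Y) p))))) p v⇝z)

-- Arboreal decompositions whose bags are singletons

select : ∀ {A B : Set} → Dec A → B → B → B
select (yes _) x y = x
select (no _)  x y = y

select-yes : ∀ {A B : Set} (d : Dec A) {x y : B} → A → select d x y ≡ x
select-yes (yes _) a = refl
select-yes (no ¬a) a = ⊥-elim (¬a a)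

select-no : ∀ {A B : Set} (d : Dec A) {x y : B} → ¬ A → select d x y ≡ y
select-no (yes a) ¬a = ⊥-elim (¬a a)
select-no (no _)  ¬a = refl

module _ (G : Digraph) (N : ℕ) where

  -- `bag` is not the part `W` of the node, which will be a singleton, but a set with room for
  -- everything that counts towards the width there. `guard` belongs to the arc from `par`.
  record Node : Set where
    constructor mkNode
    field
      par   : Fin (n G)
      desc  : Subset (n G)
      guard : Subset (n G)
      bag   : Subset (n G)

  -- A forest on the vertex set Z whose roots hang below a vertex q outside Z;
  -- Q is the room available at q for the guards of the roots.
  record Forest (q : Fin (n G)) (Z Q : Subset (n G)) : Set where
    field
      node : Fin (n G) → Node

    open module At v = Node (node v) public

    field
      attached  : ∀ {v} → v ∈ Z →
                  (par v ≡ q × guard v ⊆ Q) ⊎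
                  (par v ∈ Z × guard v ⊆ bag (par v) × ∣ desc v ∣ < ∣ desc (par v) ∣)
      bag≤      : ∀ {v} → v ∈ Z → ∣ bag v ∣ ≤ N
      self∈bag  : ∀ {v} → v ∈ Z → v ∈ bag v
      guard⊆bag : ∀ {v} → v ∈ Z → guard v ⊆ bag v
      guards    : ∀ {v} → v ∈ Z → Guarded G (guard v) (_∈ desc v)
      desc⊆     : ∀ {v} → v ∈ Z → desc v ⊆ Z
      self∈desc : ∀ {v} → v ∈ Z → v ∈ desc v
      desc-up   : ∀ {y z} → y ∈ Z → z ∈ desc y → z ≡ y ⊎ (par z ∈ Z × par z ∈ desc y)
      desc-down : ∀ {y z} → y ∈ Z → z ∈ Z → par z ∈ desc y → z ∈ desc y

  emptyForest : ∀ {q Z Q} → Empty Z → Forest q Z Q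
  emptyForest {q} {Z} {Q} empty = record
    { node      = λ _ → mkNode q ∅ ∅ ∅
    ; attached  = absurd ; bag≤ = absurd ; self∈bag = absurd ; guard⊆bag = λ v∈ → absurd v∈
    ; guards    = absurd ; desc⊆ = λ v∈ → absurd v∈ ; self∈desc = absurd
    ; desc-up   = λ v∈ → absurd v∈ ; desc-down = λ v∈ → absurd v∈
    }
    where
    absurd : ∀ {v} {A : Set} → v ∈ Z → A
    absurd v∈ = ⊥-elim (empty (_ , v∈))

  -- The combined node map is a parameter known only through two equations, so that proofs rewrite
  -- with these and never unfold the case distinction.
  module Union {q Z Q} (K : Subset (n G)) (q∉Z : q ∉ Z) (K⊆Z : K ⊆ Z)
               (F₁ : Forest q K Q) (F₂ : Forest q (Z ∩ ∁ K) Q)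
               (node : Fin (n G) → Node)
               (node₁ : ∀ {v} → v ∈ K → node v ≡ Forest.node F₁ v)
               (node₂ : ∀ {v} → v ∈ Z ∩ ∁ K → node v ≡ Forest.node F₂ v) where

    private
      module F₁ = Forest F₁
      module F₂ = Forest F₂
      open module At v = Node (node v)

    split : ∀ {v} → v ∈ Z → v ∈ K ⊎ v ∈ Z ∩ ∁ K
    split {v} v∈ with v ∈? K
    ... | yes v∈K = inj₁ v∈K
    ... | no v∉K  = inj₂ (x∈p∩q⁺ (v∈ , x∉p⇒x∈∁p v∉K))

    disjoint : ∀ {v} → v ∈ K → v ∉ Z ∩ ∁ K
    disjoint v∈K v∈ = x∈∁p⇒x∉p (p∩q⊆q Z _ v∈) v∈K

    cases : (P : Fin (n G) → Node → Set) → (∀ {v} → v ∈ K → P v (F₁.node v)) →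
            (∀ {v} → v ∈ Z ∩ ∁ K → P v (F₂.node v)) → ∀ {v} → v ∈ Z → P v (node v)
    cases P P₁ P₂ {v} v∈ with split v∈
    ... | inj₁ v∈K = subst (P v) (sym (node₁ v∈K)) (P₁ v∈K)
    ... | inj₂ v∈L = subst (P v) (sym (node₂ v∈L)) (P₂ v∈L)

    attached : ∀ {v} → v ∈ Z →
               (par v ≡ q × guard v ⊆ Q) ⊎
               (par v ∈ Z × guard v ⊆ bag (par v) × ∣ desc v ∣ < ∣ desc (par v) ∣)
    attached {v} v∈ with split v∈
    attached {v} v∈ | inj₁ v∈K rewrite node₁ v∈K with F₁.attached v∈K
    ... | inj₁ top = inj₁ top
    ... | inj₂ (p∈ , rest) rewrite node₁ p∈ = inj₂ (K⊆Z p∈ , rest)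
    attached {v} v∈ | inj₂ v∈L rewrite node₂ v∈L with F₂.attached v∈L
    ... | inj₁ top = inj₁ top
    ... | inj₂ (p∈ , rest) rewrite node₂ p∈ = inj₂ (p∩q⊆p Z _ p∈ , rest)

    desc-up : ∀ {y z} → y ∈ Z → z ∈ desc y → z ≡ y ⊎ (par z ∈ Z × par z ∈ desc y)
    desc-up {y} {z} y∈ z∈ with split y∈
    desc-up {y} {z} y∈ z∈ | inj₁ y∈K rewrite node₁ y∈K | node₁ (F₁.desc⊆ y∈K z∈)
      with F₁.desc-up y∈K z∈
    ... | inj₁ eq           = inj₁ eq
    ... | inj₂ (p∈ , p∈desc) = inj₂ (K⊆Z p∈ , p∈desc)
    desc-up {y} {z} y∈ z∈ | inj₂ y∈L rewrite node₂ y∈L | node₂ (F₂.desc⊆ y∈L z∈)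
      with F₂.desc-up y∈L z∈
    ... | inj₁ eq           = inj₁ eq
    ... | inj₂ (p∈ , p∈desc) = inj₂ (p∩q⊆p Z _ p∈ , p∈desc)

    desc-down : ∀ {y z} → y ∈ Z → z ∈ Z → par z ∈ desc y → z ∈ desc y
    desc-down y∈ z∈ p∈ with split y∈ | split z∈
    ... | inj₁ y∈K | inj₁ z∈K rewrite node₁ y∈K | node₁ z∈K = F₁.desc-down y∈K z∈K p∈
    ... | inj₂ y∈L | inj₂ z∈L rewrite node₂ y∈L | node₂ z∈L = F₂.desc-down y∈L z∈L p∈
    -- The parent of `z` is `q`, outside `Z`, or lies in the forest of `z`; neither is a descendant
    -- of `y`.
    ... | inj₁ y∈K | inj₂ z∈L rewrite node₁ y∈K | node₂ z∈L with F₂.attached z∈L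
    ...   | inj₁ (p≡q , _) = ⊥-elim (q∉Z (subst (_∈ Z) p≡q (K⊆Z (F₁.desc⊆ y∈K p∈))))
    ...   | inj₂ (p∈L , _) = ⊥-elim (disjoint (F₁.desc⊆ y∈K p∈) p∈L)
    desc-down y∈ z∈ p∈ | inj₂ y∈L | inj₁ z∈K rewrite node₂ y∈L | node₁ z∈K with F₁.attached z∈K
    ...   | inj₁ (p≡q , _) = ⊥-elim (q∉Z (subst (_∈ Z) p≡q (p∩q⊆p Z _ (F₂.desc⊆ y∈L p∈))))
    ...   | inj₂ (p∈K , _) = ⊥-elim (disjoint p∈K (F₂.desc⊆ y∈L p∈))

    forest : Forest q Z Q
    forest = record
      { node      = node
      ; attached  = attached
      ; bag≤      = cases (λ _ x → ∣ Node.bag x ∣ ≤ N) F₁.bag≤ F₂.bag≤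
      ; self∈bag  = cases (λ v x → v ∈ Node.bag x) F₁.self∈bag F₂.self∈bag
      ; guard⊆bag = cases (λ _ x → Node.guard x ⊆ Node.bag x) F₁.guard⊆bag F₂.guard⊆bag
      ; guards    = cases (λ _ x → Guarded G (Node.guard x) (_∈ Node.desc x)) F₁.guards F₂.guards
      ; desc⊆     = cases (λ _ x → Node.desc x ⊆ Z) (λ v∈ x∈ → K⊆Z (F₁.desc⊆ v∈ x∈))
                      (λ v∈ x∈ → p∩q⊆p Z _ (F₂.desc⊆ v∈ x∈))
      ; self∈desc = cases (λ v x → v ∈ Node.desc x) F₁.self∈desc F₂.self∈desc
      ; desc-up   = desc-up
      ; desc-down = desc-down
      }

  union : ∀ {q Z Q} K → q ∉ Z → K ⊆ Z → Forest q K Q → Forest q (Z ∩ ∁ K) Q → Forest q Z Q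
  union {Z = Z} K q∉Z K⊆Z F₁ F₂ =
    Union.forest K q∉Z K⊆Z F₁ F₂ (λ v → select (v ∈? K) (Forest.node F₁ v) (Forest.node F₂ v))
      (λ {v} v∈ → select-yes (v ∈? K) v∈)
      (λ {v} v∈ → select-no (v ∈? K) (x∈∁p⇒x∉p (p∩q⊆q Z _ v∈)))

  -- All of `Z` lies below the new root `y`, and the bag `Y` of `y` is exactly the room that `F`
  -- requires for the guards of its roots.
  module Graft {q Z Q Y X} (y : Fin (n G)) (y∈Z : y ∈ Z) (q∉Z : q ∉ Z)
               (X⊆Q : X ⊆ Q) (X⊆Y : X ⊆ Y) (y∈Y : y ∈ Y) (Y≤ : ∣ Y ∣ ≤ N)
               (guarded : Guarded G X (_∈ Z)) (F : Forest y (Z ∩ ∁ ⁅ y ⁆) Y)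
               (node : Fin (n G) → Node)
               (node-y : node y ≡ mkNode q Z X Y)
               (node-F : ∀ {v} → v ∈ Z ∩ ∁ ⁅ y ⁆ → node v ≡ Forest.node F v) where

    private
      module F = Forest F
      open module At v = Node (node v)

    split : ∀ {v} → v ∈ Z → v ≡ y ⊎ v ∈ Z ∩ ∁ ⁅ y ⁆
    split {v} v∈ with v ≟ᶠ y
    ... | yes v≡y = inj₁ v≡y
    ... | no v≢y  = inj₂ (x∈p∩q⁺ (v∈ , x∉p⇒x∈∁p (x≢y⇒x∉⁅y⁆ v≢y)))

    cases : (P : Fin (n G) → Node → Set) → P y (mkNode q Z X Y) →
            (∀ {v} → v ∈ Z ∩ ∁ ⁅ y ⁆ → P v (F.node v)) → ∀ {v} → v ∈ Z → P v (node v)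
    cases P P-y P-F {v} v∈ with split v∈
    ... | inj₁ refl = subst (P v) (sym node-y) P-y
    ... | inj₂ v∈F  = subst (P v) (sym (node-F v∈F)) (P-F v∈F)

    attached : ∀ {v} → v ∈ Z →
               (par v ≡ q × guard v ⊆ Q) ⊎
               (par v ∈ Z × guard v ⊆ bag (par v) × ∣ desc v ∣ < ∣ desc (par v) ∣)
    attached {v} v∈ with split v∈
    attached {v} v∈ | inj₁ refl rewrite node-y = inj₁ (refl , X⊆Q)
    attached {v} v∈ | inj₂ v∈F rewrite node-F v∈F with F.attached v∈F
    -- A root of `F` now hangs from `y`; its descendants miss `y`, hence are fewer than `Z`.
    ... | inj₁ (p≡y , ⊆Y) rewrite p≡y | node-y =
      inj₂ (y∈Z , ⊆Y , p⊂q⇒∣p∣<∣q∣ ((λ x∈ → p∩q⊆p Z _ (F.desc⊆ v∈F x∈)) , y , y∈Z ,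
        λ y∈ → x∈∁p⇒x∉p (p∩q⊆q Z _ (F.desc⊆ v∈F y∈)) (x∈⁅x⁆ y)))
    ... | inj₂ (p∈ , rest) rewrite node-F p∈ = inj₂ (p∩q⊆p Z _ p∈ , rest)

    desc-up : ∀ {u z} → u ∈ Z → z ∈ desc u → z ≡ u ⊎ (par z ∈ Z × par z ∈ desc u)
    desc-up {u} {z} u∈ z∈ with split u∈
    desc-up {u} {z} u∈ z∈ | inj₁ refl rewrite node-y with split z∈
    ... | inj₁ z≡y = inj₁ z≡y
    ... | inj₂ z∈F rewrite node-F z∈F with F.attached z∈F
    ...   | inj₁ (p≡y , _) = inj₂ (subst (_∈ Z) (sym p≡y) y∈Z , subst (_∈ Z) (sym p≡y) y∈Z)
    ...   | inj₂ (p∈ , _)  = inj₂ (p∩q⊆p Z _ p∈ , p∩q⊆p Z _ p∈)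
    desc-up {u} {z} u∈ z∈ | inj₂ u∈F rewrite node-F u∈F | node-F (F.desc⊆ u∈F z∈)
      with F.desc-up u∈F z∈
    ... | inj₁ eq            = inj₁ eq
    ... | inj₂ (p∈ , p∈desc) = inj₂ (p∩q⊆p Z _ p∈ , p∈desc)

    desc-down : ∀ {u z} → u ∈ Z → z ∈ Z → par z ∈ desc u → z ∈ desc u
    desc-down u∈ z∈ p∈ with split u∈ | split z∈
    ... | inj₁ refl | _         rewrite node-y = z∈
    ... | inj₂ u∈F  | inj₂ z∈F  rewrite node-F u∈F | node-F z∈F = F.desc-down u∈F z∈F p∈
    ... | inj₂ u∈F  | inj₁ refl rewrite node-F u∈F | node-y = ⊥-elim (q∉Z (p∩q⊆p Z _ (F.desc⊆ u∈F p∈)))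

    forest : Forest q Z Q
    forest = record
      { node      = node
      ; attached  = attached
      ; bag≤      = cases (λ _ x → ∣ Node.bag x ∣ ≤ N) Y≤ F.bag≤
      ; self∈bag  = cases (λ v x → v ∈ Node.bag x) y∈Y F.self∈bag
      ; guard⊆bag = cases (λ _ x → Node.guard x ⊆ Node.bag x) X⊆Y F.guard⊆bag
      ; guards    = cases (λ _ x → Guarded G (Node.guard x) (_∈ Node.desc x)) guarded F.guards
      ; desc⊆     = cases (λ _ x → Node.desc x ⊆ Z) id (λ v∈ x∈ → p∩q⊆p Z _ (F.desc⊆ v∈ x∈))
      ; self∈desc = cases (λ v x → v ∈ Node.desc x) y∈Z F.self∈desc
      ; desc-up   = desc-up
      ; desc-down = desc-down
      }

  graft : ∀ {q Z Q Y X} y → y ∈ Z → q ∉ Z → X ⊆ Q → X ⊆ Y → y ∈ Y → ∣ Y ∣ ≤ N →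
          Guarded G X (_∈ Z) → Forest y (Z ∩ ∁ ⁅ y ⁆) Y → Forest q Z Q
  graft {q} {Z} {Q} {Y} {X} y y∈Z q∉Z X⊆Q X⊆Y y∈Y Y≤ guarded F =
    Graft.forest y y∈Z q∉Z X⊆Q X⊆Y y∈Y Y≤ guarded F
      (λ v → select (v ≟ᶠ y) (mkNode q Z X Y) (Forest.node F v))
      (select-yes (y ≟ᶠ y) refl)
      (λ {v} v∈ → select-no (v ≟ᶠ y) (x∉⁅y⁆⇒x≢y (x∈∁p⇒x∉p (p∩q⊆q Z _ v∈))))

-- From a forest to an arboreal decomposition.

arborealDecomposition : ∀ {G w Q} r → r ∈ Q → ∣ Q ∣ ≤ suc w →
                        Forest G (suc w) r (full ∩ ∁ ⁅ r ⁆) Q → ArborealDecomposition G w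
arborealDecomposition {G} {w} {Q} r r∈Q Q≤ F = record
  { p        = n G
  ; parent   = parent
  ; root     = r
  ; rootTop  = select-yes (r ≟ᶠ r) refl
  ; rooted   = λ y → rooted y (<-wellFounded _)
  ; B        = guard
  ; W        = ⁅_⁆
  ; nonempty = λ y → y , x∈⁅x⁆ y
  ; cover    = λ v → v , x∈⁅x⁆ v
  ; disjoint = λ v y y′ v∈ v∈′ → trans (sym (x∈⁅y⁆⇒x≡y y v∈)) (x∈⁅y⁆⇒x≡y y′ v∈′)
  ; guarded  = λ x y py≡x → let y∈ , _ = just-parent py≡x in
      Guarded-resp {G} {guard y} {_∈ desc y}
        (λ {v} v∈ → v , desc⇒below y∈ v∈ (<-wellFounded _) , x∈⁅x⁆ v)
        (λ { (z , below , v∈z) → subst (_∈ desc y) (sym (x∈⁅y⁆⇒x≡y z v∈z)) (below⇒desc y∈ below) })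
        (guards y∈)
  ; width    = λ y S S⊆ → ≤-trans (p⊆q⇒∣p∣≤∣q∣ (λ {v} v∈ → width y (S⊆ v v∈))) (room≤ y)
  }
  where
  open Forest F
  N : ℕ
  N = suc w
  Z : Subset (n G)
  Z = full ∩ ∁ ⁅ r ⁆

  parent : Fin (n G) → Maybe (Fin (n G))
  parent v = select (v ≟ᶠ r) nothing (just (par v))

  ≢r⇒∈Z : ∀ {v} → v ≢ r → v ∈ Z
  ≢r⇒∈Z v≢r = x∈p∩q⁺ (∈⊤ , x∉p⇒x∈∁p (x≢y⇒x∉⁅y⁆ v≢r))

  ∈Z⇒≢r : ∀ {v} → v ∈ Z → v ≢ r
  ∈Z⇒≢r v∈ = x∉⁅y⁆⇒x≢y (x∈∁p⇒x∉p (p∩q⊆q full _ v∈))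

  parent-∈Z : ∀ {v} → v ∈ Z → parent v ≡ just (par v)
  parent-∈Z {v} v∈ = select-no (v ≟ᶠ r) (∈Z⇒≢r v∈)

  just-parent : ∀ {v x} → parent v ≡ just x → v ∈ Z × par v ≡ x
  just-parent {v} eq with v ≟ᶠ r
  just-parent ()   | yes _
  just-parent refl | no v≢r = ≢r⇒∈Z v≢r , refl

  -- Descendant sets grow strictly towards the root, so this difference falls along parent pointers
  -- and excludes cycles.
  height : Fin (n G) → ℕ
  height v = n G ∸ ∣ desc v ∣

  height-decreases : ∀ {v} → ∣ desc v ∣ < ∣ desc (par v) ∣ → height (par v) < height v
  height-decreases {v} lt = ∸-monoʳ-< lt (∣p∣≤n (desc (par v)))

  rooted : ∀ y → Acc _<_ (height y) → Below parent r y
  rooted y (acc rs) with y ≟ᶠ r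
  ... | yes refl = self
  ... | no y≢r with attached (≢r⇒∈Z y≢r)
  ...   | inj₁ (p≡r , _)    = down (trans (parent-∈Z (≢r⇒∈Z y≢r)) (cong just p≡r)) self
  ...   | inj₂ (_ , _ , lt) = down (parent-∈Z (≢r⇒∈Z y≢r)) (rooted (par y) (rs (height-decreases lt)))

  desc⇒below : ∀ {y z} → y ∈ Z → z ∈ desc y → Acc _<_ (height z) → Below parent y z
  desc⇒below {y} {z} y∈ z∈ (acc rs) with desc-up y∈ z∈
  ... | inj₁ refl = self
  ... | inj₂ (p∈Z , p∈) with attached (desc⊆ y∈ z∈)
  ...   | inj₁ (p≡r , _)    = ⊥-elim (∈Z⇒≢r p∈Z p≡r)
  ...   | inj₂ (_ , _ , lt) =
    down (parent-∈Z (desc⊆ y∈ z∈)) (desc⇒below y∈ p∈ (rs (height-decreases lt)))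

  below⇒desc : ∀ {y z} → y ∈ Z → Below parent y z → z ∈ desc y
  below⇒desc y∈ self = self∈desc y∈
  below⇒desc {y} y∈ (down eq below) =
    let z∈ , p≡ = just-parent eq in
    desc-down y∈ z∈ (subst (_∈ desc y) (sym p≡) (below⇒desc y∈ below))

  room : Fin (n G) → Subset (n G)
  room y = select (y ≟ᶠ r) Q (bag y)

  room-r : room r ≡ Q
  room-r = select-yes (r ≟ᶠ r) refl

  room-∈Z : ∀ {y} → y ∈ Z → room y ≡ bag y
  room-∈Z {y} y∈ = select-no (y ≟ᶠ r) (∈Z⇒≢r y∈)

  room≤ : ∀ y → ∣ room y ∣ ≤ N
  room≤ y with y ≟ᶠ r
  ... | yes _  = Q≤
  ... | no y≢r = bag≤ (≢r⇒∈Z y≢r)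

  width : ∀ y {v} → v ∈ ⁅ y ⁆ ⊎ ((Σ (Fin (n G)) λ x → parent y ≡ just x) × v ∈ guard y)
          ⊎ (Σ (Fin (n G)) λ z → parent z ≡ just y × v ∈ guard z) → v ∈ room y
  width y (inj₁ v∈) rewrite x∈⁅y⁆⇒x≡y y v∈ with y ≟ᶠ r
  ... | yes refl = r∈Q
  ... | no y≢r   = self∈bag (≢r⇒∈Z y≢r)
  width y {v} (inj₂ (inj₁ ((x , eq) , v∈))) =
    let y∈ , _ = just-parent eq in subst (v ∈_) (sym (room-∈Z y∈)) (guard⊆bag y∈ v∈)
  width y {v} (inj₂ (inj₂ (z , eq , v∈))) with just-parent eq
  ... | z∈ , refl with attached z∈
  ...   | inj₁ (p≡r , ⊆Q)   = subst (v ∈_) (sym (trans (cong room p≡r) room-r)) (⊆Q v∈)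
  ...   | inj₂ (p∈ , ⊆bag , _) = subst (v ∈_) (sym (room-∈Z p∈)) (⊆bag v∈)

-- From balanced separators to forests

m+m≤n+n⇒m≤n : ∀ {i j} → i + i ≤ j + j → i ≤ j
m+m≤n+n⇒m≤n i+i≤j+j = ≮⇒≥ (λ j<i → <⇒≱ (+-mono-< j<i j<i) i+i≤j+j)

module _ {G : Digraph} {w N : ℕ} (3h≤N : (suc w + suc w) + suc w ≤ N)
         (separator : ∀ X → Σ (Subset (n G)) λ Y → ∣ Y ∣ ≤ w × Balances G X Y) where

  private
    h : ℕ
    h = suc w

  -- Adding `z` costs one vertex, hence `h = suc w`, and only shrinks components. It lets `z` be a
  -- root with `z` in its bag.
  separator-through : ∀ z X → Σ (Subset (n G)) λ Y → ∣ Y ∣ ≤ h × z ∈ Y × Balances G X Y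
  separator-through z X with separator X
  ... | Y , Y≤ , bal =
    ⁅ z ⁆ ∪ Y , ∣p∪q∣≤ ⁅ z ⁆ Y (≤-reflexive (∣⁅x⁆∣≡1 z)) Y≤ , x∈p∪q⁺ (inj₁ (x∈⁅x⁆ z)) ,
    λ x → ≤-trans (+-mono-≤ (smaller x) (smaller x)) (bal x)
    where
    smaller : ∀ x → ∣ X ∩ comp G (⁅ z ⁆ ∪ Y) x ∣ ≤ ∣ X ∩ comp G Y x ∣
    smaller x = p⊆q⇒∣p∣≤∣q∣ (λ v∈ → let v∈X , v∈c = x∈p∩q⁻ X (comp G (⁅ z ⁆ ∪ Y) x) v∈ in
                                    x∈p∩q⁺ (v∈X , comp-antitone {G} (q⊆p∪q ⁅ z ⁆ Y) v∈c))

  -- `M` is the induction bound. Guards are held to `2h` so that a guard and a separator together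
  -- fit into `N`; `z` becomes the root.
  GuardedForests : ℕ → Set
  GuardedForests M = ∀ {Z X q Q z} → ∣ Z ∣ ≤ M → z ∈ Z → Guarded G X (_∈ Z) → ∣ X ∣ ≤ h + h →
                     q ∉ Z → X ⊆ Q → Forest G N q Z Q

  module Split {M} (forests : GuardedForests M) {X Y : Subset (n G)} (X≤ : ∣ X ∣ ≤ h + h)
               (Y≤ : ∣ Y ∣ ≤ h) (balances : Balances G X Y) where

    -- Balance leaves at most half of `X`, hence at most `h` vertices, in the component; with `Y`
    -- the new guard is again within `2h`.
    componentForest : ∀ {Z q} z → z ∈ Z → z ∉ X ∪ Y → Closed {G} (X ∪ Y) Z → ∣ Z ∣ ≤ M → q ∉ Z →
                      Forest G N q (comp G (X ∪ Y) z) (X ∪ Y)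
    componentForest z z∈ z∉ closed Z≤ q∉ =
      forests (≤-trans (p⊆q⇒∣p∣≤∣q∣ (closed z∈)) Z≤) (comp-refl {G} z∉) (comp-guarded {G} X Y z)
        (∣p∪q∣≤ (X ∩ comp G Y z) Y (m+m≤n+n⇒m≤n {j = h} (≤-trans (balances z) X≤)) Y≤)
        (q∉ ∘ closed z∈) (∪-least (p⊆p∪q Y ∘ p∩q⊆p X _) (q⊆p∪q X Y))

    -- Components are split off one at a time and all hang from `q`; the rest stays closed because
    -- two components are equal or disjoint.
    componentsForest : ∀ i {Z q} → ∣ Z ∣ ≤ i → ∣ Z ∣ ≤ M → (∀ {v} → v ∈ Z → v ∉ X ∪ Y) →
                       Closed {G} (X ∪ Y) Z → q ∉ Z → Forest G N q Z (X ∪ Y)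
    componentsForest i {Z} Z≤i Z≤M avoid closed q∉ with nonempty? Z
    ... | no empty = emptyForest G N empty
    componentsForest zero Z≤i _ _ _ _ | yes (z , z∈) =
      ⊥-elim (<⇒≱ (∈⇒0<∣∣ z∈) Z≤i)
    componentsForest (suc i) {Z} Z≤i Z≤M avoid closed q∉ | yes (z , z∈) =
      union G N K q∉ (closed z∈) (componentForest z z∈ (avoid z∈) closed Z≤M q∉)
        (componentsForest i (≤-pred (≤-trans smaller Z≤i)) (≤-trans (<⇒≤ smaller) Z≤M)
          (avoid ∘ p∩q⊆p Z _) closed′ (q∉ ∘ p∩q⊆p Z _))
      where
      K : Subset (n G)
      K = comp G (X ∪ Y) z
      smaller : ∣ Z ∩ ∁ K ∣ < ∣ Z ∣
      smaller = p⊂q⇒∣p∣<∣q∣ (p∩q⊆p Z _ , z , z∈ ,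
        λ z∈′ → x∈∁p⇒x∉p (p∩q⊆q Z _ z∈′) (comp-refl {G} (avoid z∈)))
      closed′ : Closed {G} (X ∪ Y) (Z ∩ ∁ K)
      closed′ u∈ v∈ = x∈p∩q⁺ (closed (p∩q⊆p Z _ u∈) v∈ ,
        x∉p⇒x∈∁p (λ v∈K → x∈∁p⇒x∉p (p∩q⊆q Z _ u∈) (comp-sym-trans {G} v∈K v∈)))

    X∪Y≤N : ∣ X ∪ Y ∣ ≤ N
    X∪Y≤N = ≤-trans (∣p∪q∣≤ X Y X≤ Y≤) 3h≤N

    -- The vertices of Y in Z are stacked on a path; V is the part of X ∪ Y above Z so far.
    stackedForest : ∀ i {Z V q} → ∣ Z ∣ ≤ i → ∣ Z ∣ ≤ M → X ⊆ V → V ⊆ X ∪ Y →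
                    Guarded G V (_∈ Z) → q ∉ Z → Forest G N q Z (X ∪ Y)
    stackedForest i {Z} {V} Z≤i Z≤M X⊆V V⊆ guarded q∉ with nonempty? (Z ∩ Y)
    ... | no empty = componentsForest i Z≤i Z≤M
      (λ v∈ → [ proj₁ guarded _ v∈ ∘ X⊆V , (λ v∈Y → empty (_ , x∈p∩q⁺ (v∈ , v∈Y))) ]′ ∘ x∈p∪q⁻ X Y)
      (Guarded⇒Closed {G} V⊆ guarded) q∉
    stackedForest zero {Z} Z≤i _ _ _ _ _ | yes (y , y∈) =
      ⊥-elim (<⇒≱ (∈⇒0<∣∣ (p∩q⊆p Z Y y∈)) Z≤i)
    stackedForest (suc i) {Z} {V} Z≤i Z≤M X⊆V V⊆ guarded q∉ | yes (y , y∈) =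
      graft G N y y∈Z q∉ V⊆ V⊆ y∈X∪Y X∪Y≤N guarded
        (stackedForest i (≤-pred (≤-trans smaller Z≤i)) (≤-trans (<⇒≤ smaller) Z≤M)
          (p⊆p∪q _ ∘ X⊆V) (∪-least V⊆ (⁅x⁆⊆ y∈X∪Y)) (Guarded-remove {G} y guarded)
          (λ y∈ → x∈∁p⇒x∉p (p∩q⊆q Z _ y∈) (x∈⁅x⁆ y)))
      where
      y∈Z : y ∈ Z
      y∈Z = p∩q⊆p Z Y y∈
      y∈X∪Y : y ∈ X ∪ Y
      y∈X∪Y = q⊆p∪q X Y (p∩q⊆q Z Y y∈)
      smaller : ∣ Z ∩ ∁ ⁅ y ⁆ ∣ < ∣ Z ∣
      smaller = ∣p∩∁⁅x⁆∣<∣p∣ y∈Z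

  -- Builds all that lies below `z` without attaching `z`, to serve both inside a forest and at the
  -- root of the whole decomposition.
  rootForest : ∀ {M} → GuardedForests M → ∀ {Z X} z → ∣ Z ∣ ≤ suc M → z ∈ Z → Guarded G X (_∈ Z) →
               ∣ X ∣ ≤ h + h →
               Σ (Subset (n G)) λ Q → X ⊆ Q × z ∈ Q × ∣ Q ∣ ≤ N × Forest G N z (Z ∩ ∁ ⁅ z ⁆) Q
  rootForest {M} forests {Z} {X} z Z≤ z∈ guarded X≤ with separator-through z X
  ... | Y , Y≤ , z∈Y , bal =
    X ∪ Y , p⊆p∪q Y , q⊆p∪q X Y z∈Y , X∪Y≤N ,
    stackedForest M smaller smaller (p⊆p∪q _) (∪-least (p⊆p∪q Y) (q⊆p∪q X Y ∘ ⁅x⁆⊆ z∈Y))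
      (Guarded-remove {G} z guarded) (λ z∈′ → x∈∁p⇒x∉p (p∩q⊆q Z _ z∈′) (x∈⁅x⁆ z))
    where
    open Split forests {X} {Y} X≤ Y≤ bal
    smaller : ∣ Z ∩ ∁ ⁅ z ⁆ ∣ ≤ M
    smaller = ≤-pred (≤-trans (∣p∩∁⁅x⁆∣<∣p∣ z∈) Z≤)

  guardedForests : ∀ M → GuardedForests M
  guardedForests zero Z≤ z∈ _ _ _ _ = ⊥-elim (<⇒≱ (∈⇒0<∣∣ z∈) Z≤)
  guardedForests (suc M) {z = z} Z≤ z∈ guarded X≤ q∉ X⊆Q =
    let Y , X⊆Y , z∈Y , Y≤ , F = rootForest (guardedForests M) z Z≤ z∈ guarded X≤ in
    graft G N z z∈ q∉ X⊆Q X⊆Y z∈Y Y≤ guarded F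

treewidth≤ : ∀ {G w W} → (suc w + suc w) + suc w ≤ suc W →
             (∀ X → Σ (Subset (n G)) λ Y → ∣ Y ∣ ≤ w × Balances G X Y) →
             Fin (n G) → DirectedTreewidth≤ G W
treewidth≤ {G} 3h≤ separator r =
  let Q , _ , r∈Q , Q≤ , F = rootForest {G} 3h≤ separator (guardedForests 3h≤ separator (n G)) {full} {∅} r
                               (≤-trans (∣p∣≤n full) (n≤1+n _)) ∈⊤
                               -- The full vertex set is guarded by the empty set, as no vertex lies
                               -- outside it.
                               ((λ _ _ → ∉⊥) , λ _ _ _ _ z∉ _ _ _ → z∉ ∈⊤)
                               (≤-trans (≤-reflexive (∣⊥∣≡0 (n G))) z≤n)
  in arborealDecomposition r r∈Q Q≤ F

-- Arithmetic of the width bound.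

n≤2^n : ∀ i → i ≤ 2 ^ i
n≤2^n zero    = z≤n
n≤2^n (suc i) = +-mono-≤ (m^n>0 2 i) (≤-trans (n≤2^n i) (m≤m+n _ 0))

n≤n*n : ∀ i → i ≤ i * i
n≤n*n zero    = z≤n
n≤n*n (suc i) = m≤m*n (suc i) (suc i)

-- Since `2k ≤ 2 ^ (2k)`, one set of ends has at most `E = 2 ^ (4k)` vertices, so
-- `h = 3 + 2e ≤ 5 * E` and `3h ≤ 16 * E = 2 ^ (4 + 4k)`; finally `k ≤ k * k`.
width-bound : ∀ k → let h = suc (havenOrder k) in (h + h) + h ≤ suc (2 ^ (4 * (k * k + 1)))
width-bound k = begin
  (h + h) + h                ≤⟨ +-mono-≤ (+-mono-≤ h≤ h≤) h≤ ⟩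
  (5 * E + 5 * E) + 5 * E    ≡⟨ sym (trans (*-distribʳ-+ E 10 5) (cong (_+ 5 * E) (*-distribʳ-+ E 5 5))) ⟩
  15 * E                     ≤⟨ *-monoˡ-≤ E (m≤m+n 15 1) ⟩
  2 ^ 4 * E                  ≡⟨ sym (^-distribˡ-+-* 2 4 (k + k + (k + k))) ⟩
  2 ^ (4 + (k + k + (k + k))) ≤⟨ ^-monoʳ-≤ 2 exponent ⟩
  2 ^ (4 * (k * k + 1))      ≤⟨ n≤1+n _ ⟩
  suc (2 ^ (4 * (k * k + 1))) ∎
  where
  open ≤-Reasoning
  h e E : ℕ
  h = suc (havenOrder k)
  e = 2 ^ (k + k) * (k + k)
  E = 2 ^ (k + k + (k + k))

  e≤E : e ≤ E
  e≤E = ≤-trans (*-monoʳ-≤ (2 ^ (k + k)) (n≤2^n (k + k)))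
                (≤-reflexive (sym (^-distribˡ-+-* 2 (k + k) (k + k))))

  h≤ : h ≤ 5 * E
  h≤ = begin
    3 + (e + e)       ≤⟨ +-mono-≤ (*-monoʳ-≤ 3 (m^n>0 2 (k + k + (k + k)))) (+-mono-≤ e≤E e≤E) ⟩
    3 * E + (E + E)   ≡⟨ cong (λ x → 3 * E + (E + x)) (sym (+-identityʳ E)) ⟩
    3 * E + 2 * E     ≡⟨ sym (*-distribʳ-+ E 3 2) ⟩
    5 * E             ∎

  exponent : 4 + (k + k + (k + k)) ≤ 4 * (k * k + 1)
  exponent = begin
    4 + (k + k + (k + k)) ≡⟨ cong (4 +_) (trans (+-assoc k k (k + k)) (cong (λ x → k + (k + (k + x))) (sym (+-identityʳ k)))) ⟩
    4 + 4 * k             ≤⟨ +-monoʳ-≤ 4 (*-monoʳ-≤ 4 (n≤n*n k)) ⟩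
    4 + 4 * (k * k)       ≡⟨ sym (trans (*-distribˡ-+ 4 (k * k) 1) (+-comm (4 * (k * k)) 4)) ⟩
    4 * (k * k + 1)       ∎

theorem3 : Σ ℕ λ c → ∀ (k : ℕ) (G : Digraph) → Simple G → KCutMinimal k G →
    DirectedTreewidth≤ G (2 ^ (c * (k * k + 1)))
-- The source `s` provides the vertex at the root.
theorem3 = 4 , λ k G _ minimal →
  treewidth≤ (width-bound k) (balanced-separator {G} (kCutMinimal⇒¬Haven {k} {G} minimal)) (proj₁ minimal)
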